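{- Let $d>1$ be a real number and let $G=(V,E,w)$ be an undirected weighted graph on $n$ vertices. Then $G$ contains a weighted subgraph $H=(V,F,\tilde w)$, $F\subseteq E$, with at most $\lceil d(n-1)\rceil$ edges (so the average degree of $H$ is at most $2d$), such that $$x^T L_G x \;\le\; x^T L_H x \;\le\; \left(\frac{d+1+2\sqrt d}{d+1-2\sqrt d}\right) x^T L_G x\qquad\text{for all } x\in\mathbb{R}^V .$$
   Context: A weighted undirected graph $G=(V,E,w)$ is a finite simple graph with edge weights $w_e>0$ for $e\in E$. Its Laplacian $L_G$ is the symmetric $V\times V$ matrix with quadratic form $x^T L_G x=\sum_{(u,v)\in E} w_{u,v}(x_u-x_v)^2$. A weighted subgraph $H=(V,F,\tilde w)$ of $G$ has the same vertex set, an edge set $F\subseteq E$, and positive edge weights $\tilde w$, which need not agree with the weights $w$ of $G$; $L_H$ is its Laplacian. -}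

module Defs where

open import Level using (_⊔_; suc)
open import Algebra.Bundles using (CommutativeRing)
open import Algebra.Apartness.Bundles using (HeytingField)
import Algebra.Apartness.Properties.HeytingCommutativeRing as HeytingProperties
import Algebra.Definitions.RawMonoid as RawMonoidOps
import Algebra.Properties.Ring as RingProperties
import Algebra.Properties.Semiring.Sum as SemiringSum
open import Data.Bool.Base using (Bool; true; false; if_then_else_; _∧_)
open import Data.Empty using (⊥-elim)
open import Data.Fin.Base using (Fin) renaming (zero to fzero; suc to fsuc)
open import Data.Fin.Properties using (_≟_; _<?_; <-cmp)
open import Data.Nat.Base as ℕ using (ℕ; zero; NonZero)
import Data.Nat.Properties as ℕ
open import Data.Product.Base using (∃; _×_; _,_; proj₁)
open import Data.Sum.Base using (_⊎_; inj₁; inj₂)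
open import Data.Vec.Functional using (Vector)
open import Relation.Binary.Core using (Rel)
open import Relation.Binary.Definitions using (tri<; tri≈; tri>)
open import Relation.Binary.PropositionalEquality as ≡ using (_≡_)
import Relation.Binary.Reasoning.Setoid as SetoidReasoning
open import Relation.Binary.Structures using (IsStrictPartialOrder)
open import Relation.Nullary.Decidable using (yes; no; does; dec-true; dec-false)
open import Relation.Nullary.Negation.Core using (¬_)

-- The real numbers, axiomatised as an Archimedean, Cauchy-complete ordered
-- field.  Classically these axioms are categorical: every model is isomorphic
-- to ℝ.  They are phrased with apartness and a strict order that is not assumed
-- decidable, so that they are also the axioms satisfied by constructive
-- (Bishop) reals.
record RealNumbers c ℓ₁ ℓ₂ : Set (suc (c ⊔ ℓ₁ ⊔ ℓ₂)) where
  infix 4 _<_ _≤_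

  field
    heytingField : HeytingField c ℓ₁ ℓ₂

  open HeytingField heytingField public

  commutativeRing : CommutativeRing c ℓ₁
  commutativeRing = record { isCommutativeRing = isCommutativeRing }

  open CommutativeRing commutativeRing public
    using (ring; semiring; +-rawMonoid)

  fromℕ : ℕ → Carrier
  fromℕ k = RawMonoidOps._×_ +-rawMonoid k 1#

  field
    _<_                  : Rel Carrier ℓ₂
    isStrictPartialOrder : IsStrictPartialOrder _≈_ _<_
    <⇒#                  : ∀ {x y} → x < y → x # y
    #⇒<⊎>                : ∀ {x y} → x # y → x < y ⊎ y < x
    +-monoʳ-<            : ∀ z {x y} → x < y → z + x < z + y
    *-pos                : ∀ {x y} → 0# < x → 0# < y → 0# < x * y

  -- Equivalent to "x < y or x ≈ y" in classical logic.
  _≤_ : Rel Carrier ℓ₂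
  x ≤ y = ¬ (y < x)

  -- ∣ x - y ∣ < ε
  Within : Carrier → Carrier → Carrier → Set ℓ₂
  Within ε x y = (x - y < ε) × (y - x < ε)

  Cauchy : (ℕ → Carrier) → Set (c ⊔ ℓ₂)
  Cauchy a = ∀ ε → 0# < ε →
    ∃ λ N → ∀ i j → N ℕ.≤ i → N ℕ.≤ j → Within ε (a i) (a j)

  ConvergesTo : (ℕ → Carrier) → Carrier → Set (c ⊔ ℓ₂)
  ConvergesTo a l = ∀ ε → 0# < ε →
    ∃ λ N → ∀ i → N ℕ.≤ i → Within ε (a i) l

  field
    archimedean : ∀ x → ∃ λ k → x < fromℕ k
    complete    : ∀ a → Cauchy a → ∃ λ l → ConvergesTo a l

module GraphsOver {c ℓ₁ ℓ₂} (ℝ : RealNumbers c ℓ₁ ℓ₂) where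
  open RealNumbers ℝ public

  private
    open HeytingProperties (HeytingField.heytingCommutativeRing heytingField)
      using (1#0; x#0y#0→xy#0; #-congʳ; invertibleʳ⇒#; x-0≈x)
    open RingProperties ring
      using (x[y-z]≈xy-xz; [y-z]x≈yx-zx; -‿distribˡ-*; -‿distribʳ-*; -0#≈0#; -‿involutive;
             ⁻¹-anti-homo-//; -‿+-comm)
    open IsStrictPartialOrder isStrictPartialOrder
      using (<-respˡ-≈; <-respʳ-≈) renaming (irrefl to <-irrefl; trans to <-trans)

  IsSqrt : Carrier → Carrier → Set (ℓ₁ ⊔ ℓ₂)
  IsSqrt s x = (0# ≤ s) × (s * s ≈ x)

  -- For an x whose ceiling is nonnegative.
  IsCeiling : ℕ → Carrier → Set ℓ₂
  IsCeiling m x = (x ≤ fromℕ m) × (fromℕ m < x + 1#)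

  quotient : (x y : Carrier) → y # 0# → Carrier
  quotient x y y#0 = x * proj₁ (#⇒invertible y#0)

  0<1 : 0# < 1#
  0<1 with #⇒<⊎> 1#0
  ... | inj₂ 0<1 = 0<1
  ... | inj₁ 1<0 = ⊥-elim (<-irrefl refl (<-trans 1<0 0<1′))
    where
    0<-1 : 0# < - 1#
    0<-1 = <-respˡ-≈ (-‿inverseˡ 1#) (<-respʳ-≈ (+-identityʳ (- 1#)) (+-monoʳ-< (- 1#) 1<0))
    0<1′ : 0# < 1#
    0<1′ = <-respʳ-≈
      (trans (sym (-‿distribˡ-* 1# (- 1#)))
        (trans (-‿cong (*-identityˡ (- 1#))) (-‿involutive 1#)))
      (*-pos 0<-1 0<-1)

  fromℕ-pos : ∀ k → 0# < fromℕ (ℕ.suc k)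
  fromℕ-pos zero      = <-respʳ-≈ (sym (+-identityʳ 1#)) 0<1
  fromℕ-pos (ℕ.suc k) = <-trans 0<1
    (<-respˡ-≈ (+-identityʳ 1#) (+-monoʳ-< 1# (fromℕ-pos k)))

  fromℕ#0 : ∀ k .{{_ : NonZero k}} → fromℕ k # 0#
  fromℕ#0 (ℕ.suc k) = #-sym (<⇒# (fromℕ-pos k))

  -- d + 1 - 2√d = (√d - 1)², and √d - 1 is invertible because
  -- (√d - 1)(√d + 1) = d - 1 is.
  denominator#0 : ∀ {d s} → 1# < d → IsSqrt s d →
                  ((d + 1#) - fromℕ 2 * s) # 0#
  denominator#0 {d} {s} 1<d (_ , ss≈d) =
    #-congʳ square (x#0y#0→xy#0 s-1#0 s-1#0)
    where
    open SetoidReasoning setoid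

    t : Carrier
    t = s - 1#

    difference : t * (s + 1#) ≈ d - 1#
    difference = begin
      t * (s + 1#)                ≈⟨ distribˡ t s 1# ⟩
      t * s + t * 1#              ≈⟨ +-cong ([y-z]x≈yx-zx s s 1#) (*-identityʳ t) ⟩
      (s * s - 1# * s) + (s - 1#) ≈⟨ +-congʳ (+-cong ss≈d (-‿cong (*-identityˡ s))) ⟩
      (d - s) + (s - 1#)          ≈⟨ +-assoc d (- s) t ⟩
      d + (- s + (s - 1#))        ≈⟨ +-congˡ (+-assoc (- s) s (- 1#)) ⟨
      d + ((- s + s) - 1#)        ≈⟨ +-congˡ (+-congʳ (-‿inverseˡ s)) ⟩
      d + (0# - 1#)               ≈⟨ +-congˡ (+-identityˡ (- 1#)) ⟩
      d - 1#                      ∎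

    s#1 : s # 1#
    s#1 with #⇒invertible (#-sym (<⇒# 1<d))
    ... | v , _ , [d-1]v≈1 = invertibleʳ⇒# ((s + 1#) * v , (begin
      t * ((s + 1#) * v) ≈⟨ *-assoc t (s + 1#) v ⟨
      (t * (s + 1#)) * v ≈⟨ *-congʳ difference ⟩
      (d - 1#) * v       ≈⟨ [d-1]v≈1 ⟩
      1#                 ∎))

    s-1#0 : t # 0#
    s-1#0 with #⇒invertible s#1
    ... | v , _ , tv≈1 = invertibleʳ⇒# (v , trans (*-congʳ (x-0≈x t)) tv≈1)

    2s≈s+s : fromℕ 2 * s ≈ s + s
    2s≈s+s = begin
      (1# + (1# + 0#)) * s ≈⟨ *-congʳ (+-congˡ (+-identityʳ 1#)) ⟩
      (1# + 1#) * s        ≈⟨ distribʳ s 1# 1# ⟩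
      1# * s + 1# * s      ≈⟨ +-cong (*-identityˡ s) (*-identityˡ s) ⟩
      s + s                ∎

    square : t * t ≈ (d + 1#) - fromℕ 2 * s
    square = begin
      t * (s - 1#)                      ≈⟨ x[y-z]≈xy-xz t s 1# ⟩
      t * s - t * 1#                    ≈⟨ +-cong ([y-z]x≈yx-zx s s 1#) (-‿cong (*-identityʳ t)) ⟩
      (s * s - 1# * s) - (s - 1#)       ≈⟨ +-cong (+-cong ss≈d (-‿cong (*-identityˡ s))) (⁻¹-anti-homo-// s 1#) ⟩
      (d - s) + (1# - s)                ≈⟨ +-assoc d (- s) (1# - s) ⟩
      d + (- s + (1# - s))              ≈⟨ +-congˡ (+-assoc (- s) 1# (- s)) ⟨
      d + ((- s + 1#) - s)              ≈⟨ +-congˡ (+-congʳ (+-comm (- s) 1#)) ⟩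
      d + ((1# - s) - s)                ≈⟨ +-congˡ (+-assoc 1# (- s) (- s)) ⟩
      d + (1# + (- s + - s))            ≈⟨ +-assoc d 1# (- s + - s) ⟨
      (d + 1#) + (- s + - s)            ≈⟨ +-congˡ (-‿+-comm s s) ⟩
      (d + 1#) - (s + s)                ≈⟨ +-congˡ (-‿cong 2s≈s+s) ⟨
      (d + 1#) - fromℕ 2 * s            ∎

  approximationFactor : ∀ d s → 1# < d → IsSqrt s d → Carrier
  approximationFactor d s 1<d s-sqrt =
    quotient ((d + 1#) + fromℕ 2 * s) ((d + 1#) - fromℕ 2 * s)
             (denominator#0 1<d s-sqrt)

  -- Values of weight on non-adjacent pairs are irrelevant.
  record WeightedGraph (n : ℕ) : Set (c ⊔ ℓ₁ ⊔ ℓ₂) where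
    field
      adj        : Fin n → Fin n → Bool
      adj-sym    : ∀ u v → adj u v ≡ adj v u
      adj-irrefl : ∀ u → adj u u ≡ false
      weight     : Fin n → Fin n → Carrier
      weight-sym : ∀ u v → adj u v ≡ true → weight u v ≈ weight v u
      weight-pos : ∀ u v → adj u v ≡ true → 0# < weight u v

  open WeightedGraph

  -- Inclusion of edge sets only: the weights need not agree.
  _⊆ᴱ_ : ∀ {n} → WeightedGraph n → WeightedGraph n → Set
  H ⊆ᴱ G = ∀ u v → adj H u v ≡ true → adj G u v ≡ true

  private
    module ∑ℕ = SemiringSum ℕ.+-*-semiring
    module ∑ℝ = SemiringSum semiring

  module _ {n : ℕ} (G : WeightedGraph n) where

    -- Each edge {u , v} is counted once, as the pair with u < v.
    isEdge : Fin n → Fin n → Bool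
    isEdge u v = does (u <? v) ∧ adj G u v

    numEdges : ℕ
    numEdges = ∑ℕ.sum λ u → ∑ℕ.sum λ v → if isEdge u v then 1 else 0

    degree : Fin n → ℕ
    degree u = ∑ℕ.sum λ v → if adj G u v then 1 else 0

    averageDegree : .{{_ : NonZero n}} → Carrier
    averageDegree = quotient (fromℕ (∑ℕ.sum degree)) (fromℕ n) (fromℕ#0 n)

    adjacency : Fin n → Fin n → Carrier
    adjacency u v = if adj G u v then weight G u v else 0#

    laplacian : Fin n → Fin n → Carrier
    laplacian u v = if does (u ≟ v) then ∑ℝ.sum (adjacency u) else - adjacency u v

  quadForm : ∀ {n} → (Fin n → Fin n → Carrier) → Vector Carrier n → Carrier
  quadForm M x = ∑ℝ.sum λ u → ∑ℝ.sum λ v → x u * M u v * x v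

  private
    open SetoidReasoning setoid

    sum-δ : ∀ {n} (u : Fin n) y → ∑ℝ.sum (λ v → if does (u ≟ v) then y else 0#) ≈ y
    sum-δ {ℕ.suc n} fzero    y = trans (+-congˡ (∑ℝ.sum-replicate-zero n)) (+-identityʳ y)
    sum-δ {ℕ.suc n} (fsuc u) y = trans (+-identityˡ _) (sum-δ u y)

    symmetrise : ∀ {n} (f : Fin n → Fin n → Carrier) → (∀ u → f u u ≈ 0#) →
      ∑ℝ.sum (λ u → ∑ℝ.sum λ v → f u v) ≈
      ∑ℝ.sum (λ u → ∑ℝ.sum λ v → if does (u <? v) then f u v + f v u else 0#)
    symmetrise {n} f diag = begin
      ∑ℝ.sum (λ u → ∑ℝ.sum λ v → f u v)
        ≈⟨ ∑ℝ.sum-cong-≋ (λ u → ∑ℝ.sum-cong-≋ λ v → split u v) ⟩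
      ∑ℝ.sum (λ u → ∑ℝ.sum λ v → g u v + h v u)
        ≈⟨ ∑ℝ.sum-cong-≋ (λ u → ∑ℝ.∑-distrib-+ (g u) (λ v → h v u)) ⟩
      ∑ℝ.sum (λ u → ∑ℝ.sum (g u) + ∑ℝ.sum λ v → h v u)
        ≈⟨ ∑ℝ.∑-distrib-+ (λ u → ∑ℝ.sum (g u)) _ ⟩
      ∑ℝ.sum (λ u → ∑ℝ.sum (g u)) + ∑ℝ.sum (λ u → ∑ℝ.sum λ v → h v u)
        ≈⟨ +-congˡ (∑ℝ.∑-comm (λ u v → h v u)) ⟩
      ∑ℝ.sum (λ u → ∑ℝ.sum (g u)) + ∑ℝ.sum (λ u → ∑ℝ.sum (h u))
        ≈⟨ ∑ℝ.∑-distrib-+ (λ u → ∑ℝ.sum (g u)) _ ⟨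
      ∑ℝ.sum (λ u → ∑ℝ.sum (g u) + ∑ℝ.sum (h u))
        ≈⟨ ∑ℝ.sum-cong-≋ (λ u → sym (∑ℝ.∑-distrib-+ (g u) (h u))) ⟩
      ∑ℝ.sum (λ u → ∑ℝ.sum λ v → g u v + h u v)
        ≈⟨ ∑ℝ.sum-cong-≋ (λ u → ∑ℝ.sum-cong-≋ λ v → merge (does (u <? v)) (f u v) (f v u)) ⟩
      ∑ℝ.sum (λ u → ∑ℝ.sum λ v → if does (u <? v) then f u v + f v u else 0#) ∎
      where
      g h : Fin n → Fin n → Carrier
      g u v = if does (u <? v) then f u v else 0#
      h u v = if does (u <? v) then f v u else 0#

      merge : ∀ b x y → (if b then x else 0#) + (if b then y else 0#) ≈ (if b then x + y else 0#)
      merge true  x y = refl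
      merge false x y = +-identityˡ 0#

      split : ∀ u v → f u v ≈ g u v + h v u
      split u v with <-cmp u v
      ... | tri< u<v _ v≮u rewrite dec-true (u <? v) u<v | dec-false (v <? u) v≮u =
        sym (+-identityʳ _)
      ... | tri> u≮v _ v<u rewrite dec-false (u <? v) u≮v | dec-true (v <? u) v<u =
        sym (+-identityˡ _)
      ... | tri≈ u≮u ≡.refl _ rewrite dec-false (u <? u) u≮u =
        trans (diag u) (sym (+-identityˡ 0#))

  -- The matrix above is the one whose quadratic form is the sum over edges of
  -- w_uv (x_u - x_v)².
  laplacian-form : ∀ {n} (G : WeightedGraph n) (x : Vector Carrier n) →
    quadForm (laplacian G) x ≈
    ∑ℝ.sum λ u → ∑ℝ.sum λ v →
      if isEdge G u v then weight G u v * ((x u - x v) * (x u - x v)) else 0#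
  laplacian-form {n} G x = begin
    quadForm (laplacian G) x
      ≈⟨ ∑ℝ.sum-cong-≋ row ⟩
    ∑ℝ.sum (λ u → ∑ℝ.sum λ v → f u v)
      ≈⟨ symmetrise f diag ⟩
    ∑ℝ.sum (λ u → ∑ℝ.sum λ v → if does (u <? v) then f u v + f v u else 0#)
      ≈⟨ ∑ℝ.sum-cong-≋ (λ u → ∑ℝ.sum-cong-≋ λ v → edge (does (u <? v)) u v) ⟩
    ∑ℝ.sum (λ u → ∑ℝ.sum λ v →
      if isEdge G u v then weight G u v * ((x u - x v) * (x u - x v)) else 0#) ∎
    where
    a = adjacency G

    f : Fin n → Fin n → Carrier
    f u v = a u v * (x u * (x u - x v))

    a-diag : ∀ u → a u u ≡ 0#
    a-diag u rewrite adj-irrefl G u = ≡.refl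

    diag : ∀ u → f u u ≈ 0#
    diag u = trans (*-congʳ (reflexive (a-diag u))) (zeroˡ _)

    entry : ∀ u v → x u * laplacian G u v * x v ≈
      (if does (u ≟ v) then x u * ∑ℝ.sum (a u) * x u else 0#) + - (x u * a u v * x v)
    entry u v with u ≟ v
    ... | yes ≡.refl = begin
      x u * ∑ℝ.sum (a u) * x u                        ≈⟨ +-identityʳ _ ⟨
      x u * ∑ℝ.sum (a u) * x u + 0#                   ≈⟨ +-congˡ -0#≈0# ⟨
      x u * ∑ℝ.sum (a u) * x u + - 0#                 ≈⟨ +-congˡ (-‿cong (trans (*-congʳ (trans (*-congˡ (reflexive (a-diag u))) (zeroʳ _))) (zeroˡ _))) ⟨
      x u * ∑ℝ.sum (a u) * x u + - (x u * a u u * x u) ∎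
    ... | no  _ = begin
      x u * - a u v * x v           ≈⟨ *-congʳ (sym (-‿distribʳ-* _ _)) ⟩
      - (x u * a u v) * x v         ≈⟨ sym (-‿distribˡ-* _ _) ⟩
      - (x u * a u v * x v)         ≈⟨ +-identityˡ _ ⟨
      0# + - (x u * a u v * x v)    ∎

    term : ∀ u v → x u * a u v * x u + - (x u * a u v * x v) ≈ f u v
    term u v = begin
      x u * a u v * x u - x u * a u v * x v ≈⟨ x[y-z]≈xy-xz _ _ _ ⟨
      x u * a u v * (x u - x v)             ≈⟨ *-congʳ (*-comm _ _) ⟩
      a u v * x u * (x u - x v)             ≈⟨ *-assoc _ _ _ ⟩
      f u v                                 ∎

    row : ∀ u → ∑ℝ.sum (λ v → x u * laplacian G u v * x v) ≈ ∑ℝ.sum (f u)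
    row u = begin
      ∑ℝ.sum (λ v → x u * laplacian G u v * x v)
        ≈⟨ ∑ℝ.sum-cong-≋ (entry u) ⟩
      ∑ℝ.sum (λ v → onDiag v + offDiag v)
        ≈⟨ ∑ℝ.∑-distrib-+ onDiag offDiag ⟩
      ∑ℝ.sum onDiag + ∑ℝ.sum offDiag
        ≈⟨ +-congʳ (sum-δ u _) ⟩
      x u * ∑ℝ.sum (a u) * x u + ∑ℝ.sum offDiag
        ≈⟨ +-congʳ (*-congʳ (∑ℝ.*-distribˡ-sum (x u) (a u))) ⟩
      ∑ℝ.sum (λ v → x u * a u v) * x u + ∑ℝ.sum offDiag
        ≈⟨ +-congʳ (∑ℝ.*-distribʳ-sum (x u) (λ v → x u * a u v)) ⟩
      ∑ℝ.sum spread + ∑ℝ.sum offDiag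
        ≈⟨ ∑ℝ.∑-distrib-+ spread offDiag ⟨
      ∑ℝ.sum (λ v → spread v + offDiag v)
        ≈⟨ ∑ℝ.sum-cong-≋ (term u) ⟩
      ∑ℝ.sum (f u) ∎
      where
      onDiag offDiag spread : Fin n → Carrier
      onDiag  v = if does (u ≟ v) then x u * ∑ℝ.sum (a u) * x u else 0#
      offDiag v = - (x u * a u v * x v)
      spread  v = x u * a u v * x u

    square : ∀ y z → y * (y - z) + z * (z - y) ≈ (y - z) * (y - z)
    square y z = begin
      y * (y - z) + z * (z - y)     ≈⟨ +-congˡ (*-congˡ (⁻¹-anti-homo-// y z)) ⟨
      y * (y - z) + z * - (y - z)   ≈⟨ +-congˡ (-‿distribʳ-* z (y - z)) ⟨
      y * (y - z) - z * (y - z)     ≈⟨ [y-z]x≈yx-zx (y - z) y z ⟨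
      (y - z) * (y - z)             ∎

    edge : ∀ b u v → (if b then f u v + f v u else 0#) ≈
      (if b ∧ adj G u v then weight G u v * ((x u - x v) * (x u - x v)) else 0#)
    edge false u v = refl
    edge true  u v with adj G u v in eq | adj G v u in eq′
    ... | false | false = trans (+-cong (zeroˡ _) (zeroˡ _)) (+-identityˡ 0#)
    ... | true  | true  = begin
      weight G u v * (x u * (x u - x v)) + weight G v u * (x v * (x v - x u))
        ≈⟨ +-congˡ (*-congʳ (weight-sym G u v eq)) ⟨
      weight G u v * (x u * (x u - x v)) + weight G u v * (x v * (x v - x u))
        ≈⟨ distribˡ _ _ _ ⟨
      weight G u v * (x u * (x u - x v) + x v * (x v - x u))
        ≈⟨ *-congˡ (square (x u) (x v)) ⟩
      weight G u v * ((x u - x v) * (x u - x v)) ∎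
    ... | false | true  with () ← ≡.trans (≡.sym eq) (≡.trans (adj-sym G u v) eq′)
    ... | true  | false with () ← ≡.trans (≡.sym eq) (≡.trans (adj-sym G u v) eq′)

{-# OPTIONS --safe #-}

-- The two-barrier argument of Batson, Spielman and Srivastava, run without square
-- roots, eigenvalues or inverse matrices.  Each edge e is a linear functional
-- f e x = x u - x v on vectors with x 0 = 0, and the Laplacians of G and of the
-- sparsifier under construction are M = ∑ w e (f e)² and A = ∑ t e (f e)².  The
-- potential Tr (B⁻¹M) of a positive form B is ∑ w e (f e (p e)), where p e represents
-- the functional f e with respect to B; it is kept bounded for B = u M - A and
-- B = A - l M while u and l advance by (√d + 1) / (√d - 1) and 1 at each step.
-- Averaging over the edges with weights w e yields one whose gain is strictly
-- positive, because the upper potential strictly decreases when u advances; so the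
-- edge can be found although the order is not decidable, and adding a suitable
-- multiple of it to A restores both bounds.
--
-- A disconnected G is first made connected by joining roots of its components.  The
-- added edges are dropped at the end: shifting x by constants on the components makes
-- them invisible without changing the form of G.
module Submission where

open import Defs
open import Algebra.Apartness.Bundles using (HeytingField)
import Algebra.Apartness.Properties.HeytingCommutativeRing as HeytingProperties
open import Algebra.Bundles using (CommutativeRing; RawRing; Semiring)
import Algebra.Properties.Semiring.Sum as SemiringSum
open import Data.Bool.Base using (Bool; true; false; if_then_else_; _∧_; _∨_; not)
open import Data.Bool.Properties using (∧-comm; ∧-zeroʳ; ∨-comm; ∨-identityʳ; ∨-zeroʳ) renaming (_≟_ to _≟ᵇ_)
open import Data.Empty using (⊥; ⊥-elim)
open import Data.Fin.Base using (Fin; combine; remQuot; _↑ˡ_; _↑ʳ_) renaming (zero to fzero; suc to fsuc; _<_ to _<ᶠ_)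
open import Data.Fin.Properties using (_≟_; _<?_; <-cmp; remQuot-combine) renaming (<-irrefl to <ᶠ-irrefl; <-asym to <ᶠ-asym)
open import Data.Maybe.Base using (Maybe; just; nothing)
open import Data.Nat.Base as ℕ using (ℕ; zero; suc; NonZero)
import Data.Nat.Properties as ℕ
open import Data.Product.Base using (Σ; ∃; ∃₂; _×_; _,_; proj₁; proj₂)
open import Data.Sum.Base using (_⊎_; inj₁; inj₂; [_,_]′)
open import Data.Vec.Functional using (Vector)
open import Function.Base using (_∘_; _$_; _|>_)
open import Level using (_⊔_)
open import Relation.Binary.Definitions using (tri<; tri≈; tri>)
open import Relation.Binary.PropositionalEquality as ≡ using (_≡_; _≢_)
open import Relation.Binary.Structures using (IsPreorder; IsStrictPartialOrder)
open import Relation.Nullary.Decidable using (Dec; yes; no; does; dec-true; dec-false)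
open import Relation.Nullary.Negation.Core using (¬_)

-- The undecidable order shapes the invariant. Strict definiteness of u M - A and A - l M is not
-- carried along: a `Barrier` keeps nonnegativity, a chosen representative of each functional, and
-- the bound on the potential. Solvability after a shift is earned afresh. Raising u adds a positive
-- multiple of M; a lower potential at most ε < 1 gives M ≤ ε (A - l M), so A - (l + 1) M still
-- dominates a positive multiple of M. Inequalities `≤` are negations and admit case distinctions;
-- only the edge must actually be found.
--
-- The constants come from the averaging. With s = √d and lower potential bound 1/s, the averages
-- compare when 1/δ + ε = 1 - 1/s, where δ is the upper step and ε the upper potential bound; δ = (s
-- + 1)/(s - 1) gives ε = 1/(s δ). In dimension n - 1 the form a M has potential (n - 1)/a, so
-- starting exactly at the bounds means u = (n - 1) s δ and l = -(n - 1) s. After m ≥ d (n - 1)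
-- steps, u/l is at most ((s + 1)/(s - 1))².

-- A ring solver with integer coefficients.

module IntegerCoefficients {c ℓ} (R : CommutativeRing c ℓ) where
  open CommutativeRing R hiding (zero)
  open import Algebra.Solver.Ring.AlmostCommutativeRing
    using (_-Raw-AlmostCommutative⟶_; fromCommutativeRing)
  open import Algebra.Properties.Ring ring
    using (-0#≈0#; -‿+-comm; -‿distribˡ-*; -‿distribʳ-*; -‿involutive; ⁻¹-anti-homo-//)
  open import Algebra.Properties.CommutativeSemigroup +-commutativeSemigroup using (interchange)
  open import Algebra.Properties.Semiring.Mult.TCOptimised semiring using (×-homo-+; ×1-homo-*) renaming (_×_ to _·_)
  open import Relation.Binary.Reasoning.Setoid setoid

  private
    -- (a , b) stands for a - b; the split on b makes (0 , 0) and (1 , 0) evaluate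
    -- to 0# and 1# on the nose.
    ⟦_⟧ : ℕ × ℕ → Carrier
    ⟦ a , zero  ⟧ = a · 1#
    ⟦ a , suc b ⟧ = a · 1# - suc b · 1#

    ⟦⟧-difference : ∀ a b → ⟦ a , b ⟧ ≈ a · 1# - b · 1#
    ⟦⟧-difference a zero    = sym (trans (+-congˡ -0#≈0#) (+-identityʳ _))
    ⟦⟧-difference a (suc b) = refl

    -- The solver compares normal forms syntactically, so every difference
    -- needs a unique representative.
    reduce : ℕ → ℕ → ℕ × ℕ
    reduce (suc a) (suc b) = reduce a b
    reduce a       zero    = a , zero
    reduce zero    (suc b) = zero , suc b

    -- The solver cancels monomials by computing with coefficients, for which the abstract ring has
    -- no decidable equality; integers, written as reduced differences of naturals, have one.
    differences : RawRing _ _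
    differences = record
      { Carrier = ℕ × ℕ
      ; _≈_     = _≡_
      ; _+_     = λ { (a , b) (a′ , b′) → reduce (a ℕ.+ a′) (b ℕ.+ b′) }
      ; _*_     = λ { (a , b) (a′ , b′) → reduce (a ℕ.* a′ ℕ.+ b ℕ.* b′) (a ℕ.* b′ ℕ.+ b ℕ.* a′) }
      ; -_      = λ { (a , b) → b , a }
      ; 0#      = 0 , 0
      ; 1#      = 1 , 0
      }

    difference-+ : ∀ x y z w → (x + y) - (z + w) ≈ (x - z) + (y - w)
    difference-+ x y z w = trans (+-congˡ (sym (-‿+-comm z w))) (interchange x y (- z) (- w))

    difference-* : ∀ x y z w → (x - y) * (z - w) ≈ (x * z + y * w) - (x * w + y * z)
    difference-* x y z w = begin
      (x - y) * (z - w)                             ≈⟨ distribʳ _ _ _ ⟩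
      x * (z - w) + - y * (z - w)                   ≈⟨ +-cong (distribˡ _ _ _) (distribˡ _ _ _) ⟩
      (x * z + x * - w) + (- y * z + - y * - w)     ≈⟨ +-cong (+-congˡ (sym (-‿distribʳ-* x w))) (+-cong (sym (-‿distribˡ-* y z)) y*w) ⟩
      (x * z - x * w) + (- (y * z) + y * w)         ≈⟨ +-congˡ (+-comm _ _) ⟩
      (x * z - x * w) + (y * w - y * z)             ≈⟨ difference-+ _ _ _ _ ⟨
      (x * z + y * w) - (x * w + y * z)             ∎
      where
      y*w : - y * - w ≈ y * w
      y*w = trans (sym (-‿distribˡ-* y (- w))) (trans (-‿cong (sym (-‿distribʳ-* y w))) (-‿involutive _))

    ⟦reduce⟧ : ∀ a b → ⟦ reduce a b ⟧ ≈ a · 1# - b · 1#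
    ⟦reduce⟧ (suc a) (suc b) = begin
      ⟦ reduce a b ⟧                       ≈⟨ ⟦reduce⟧ a b ⟩
      a · 1# - b · 1#                      ≈⟨ +-identityˡ _ ⟨
      0# + (a · 1# - b · 1#)               ≈⟨ +-congʳ (-‿inverseʳ 1#) ⟨
      (1# - 1#) + (a · 1# - b · 1#)        ≈⟨ difference-+ 1# (a · 1#) 1# (b · 1#) ⟨
      (1# + a · 1#) - (1# + b · 1#)        ≈⟨ +-cong (×-homo-+ 1# 1 a) (-‿cong (×-homo-+ 1# 1 b)) ⟨
      suc a · 1# - suc b · 1#              ∎
    ⟦reduce⟧ zero    zero    = ⟦⟧-difference 0 0
    ⟦reduce⟧ (suc a) zero    = ⟦⟧-difference (suc a) 0
    ⟦reduce⟧ zero    (suc b) = refl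

    morphism : differences -Raw-AlmostCommutative⟶ fromCommutativeRing R
    morphism = record
      { ⟦_⟧    = ⟦_⟧
      ; +-homo = λ { (a , b) (a′ , b′) → begin
          ⟦ reduce (a ℕ.+ a′) (b ℕ.+ b′) ⟧                 ≈⟨ ⟦reduce⟧ (a ℕ.+ a′) (b ℕ.+ b′) ⟩
          (a ℕ.+ a′) · 1# - (b ℕ.+ b′) · 1#                ≈⟨ +-cong (×-homo-+ 1# a a′) (-‿cong (×-homo-+ 1# b b′)) ⟩
          (a · 1# + a′ · 1#) - (b · 1# + b′ · 1#)          ≈⟨ difference-+ _ _ _ _ ⟩
          (a · 1# - b · 1#) + (a′ · 1# - b′ · 1#)          ≈⟨ +-cong (⟦⟧-difference a b) (⟦⟧-difference a′ b′) ⟨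
          ⟦ a , b ⟧ + ⟦ a′ , b′ ⟧                          ∎ }
      ; *-homo = λ { (a , b) (a′ , b′) → begin
          ⟦ reduce (a ℕ.* a′ ℕ.+ b ℕ.* b′) (a ℕ.* b′ ℕ.+ b ℕ.* a′) ⟧
            ≈⟨ ⟦reduce⟧ (a ℕ.* a′ ℕ.+ b ℕ.* b′) (a ℕ.* b′ ℕ.+ b ℕ.* a′) ⟩
          (a ℕ.* a′ ℕ.+ b ℕ.* b′) · 1# - (a ℕ.* b′ ℕ.+ b ℕ.* a′) · 1#
            ≈⟨ +-cong (×1-homo-*+* a a′ b b′) (-‿cong (×1-homo-*+* a b′ b a′)) ⟩
          (a · 1# * a′ · 1# + b · 1# * b′ · 1#) - (a · 1# * b′ · 1# + b · 1# * a′ · 1#)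
            ≈⟨ difference-* _ _ _ _ ⟨
          (a · 1# - b · 1#) * (a′ · 1# - b′ · 1#)
            ≈⟨ *-cong (⟦⟧-difference a b) (⟦⟧-difference a′ b′) ⟨
          ⟦ a , b ⟧ * ⟦ a′ , b′ ⟧ ∎ }
      ; -‿homo = λ { (a , b) → begin
          ⟦ b , a ⟧             ≈⟨ ⟦⟧-difference b a ⟩
          b · 1# - a · 1#       ≈⟨ ⁻¹-anti-homo-// _ _ ⟨
          - (a · 1# - b · 1#)   ≈⟨ -‿cong (⟦⟧-difference a b) ⟨
          - ⟦ a , b ⟧           ∎ }
      ; 0-homo = refl
      ; 1-homo = refl
      }
      where
      ×1-homo-*+* : ∀ a a′ b b′ →
        (a ℕ.* a′ ℕ.+ b ℕ.* b′) · 1# ≈ a · 1# * a′ · 1# + b · 1# * b′ · 1#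
      ×1-homo-*+* a a′ b b′ =
        trans (×-homo-+ 1# (a ℕ.* a′) (b ℕ.* b′)) (+-cong (×1-homo-* a a′) (×1-homo-* b b′))

    _≟′_ : ∀ p q → Maybe (⟦ p ⟧ ≈ ⟦ q ⟧)
    (a , b) ≟′ (a′ , b′) with a ℕ.+ b′ ℕ.≟ a′ ℕ.+ b
    ... | no  _  = nothing
    ... | yes eq = just (begin
      ⟦ a , b ⟧                                      ≈⟨ ⟦⟧-difference a b ⟩
      a · 1# - b · 1#                                ≈⟨ +-identityʳ _ ⟨
      (a · 1# - b · 1#) + 0#                         ≈⟨ +-congˡ (-‿inverseʳ _) ⟨
      (a · 1# - b · 1#) + (b′ · 1# - b′ · 1#)        ≈⟨ difference-+ _ _ _ _ ⟨
      (a · 1# + b′ · 1#) - (b · 1# + b′ · 1#)        ≈⟨ +-cong swapped (-‿cong (+-comm _ _)) ⟩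
      (a′ · 1# + b · 1#) - (b′ · 1# + b · 1#)        ≈⟨ difference-+ _ _ _ _ ⟩
      (a′ · 1# - b′ · 1#) + (b · 1# - b · 1#)        ≈⟨ +-congˡ (-‿inverseʳ _) ⟩
      (a′ · 1# - b′ · 1#) + 0#                       ≈⟨ +-identityʳ _ ⟩
      a′ · 1# - b′ · 1#                              ≈⟨ ⟦⟧-difference a′ b′ ⟨
      ⟦ a′ , b′ ⟧                                    ∎)
      where
      swapped : a · 1# + b′ · 1# ≈ a′ · 1# + b · 1#
      swapped = trans (sym (×-homo-+ 1# a b′)) (trans (reflexive (≡.cong (_· 1#) eq)) (×-homo-+ 1# a′ b))

  open import Algebra.Solver.Ring differences (fromCommutativeRing R) morphism _≟′_ public
    using (solve; _:=_; _:+_; _:*_; _:-_; :-_; con; Polynomial)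

  :0 :1 : ∀ {n} → Polynomial n
  :0 = con (0 , 0)
  :1 = con (1 , 0)

-- Order and finite sums in a field with undecidable order.

module OrderedField {c ℓ₁ ℓ₂} (ℝ : RealNumbers c ℓ₁ ℓ₂) where
  open GraphsOver ℝ
  open IntegerCoefficients commutativeRing public
  open HeytingProperties (HeytingField.heytingCommutativeRing heytingField)
    using (invertibleʳ⇒#; x-0≈x)
  open import Relation.Binary.Reasoning.Setoid setoid
  open IsStrictPartialOrder isStrictPartialOrder public
    using (<-respˡ-≈; <-respʳ-≈; <-resp-≈) renaming (irrefl to <-irrefl; trans to <-trans; asym to <-asym)

  open SemiringSum semiring public using (sum; sum-cong-≋; sum-replicate; ∑-distrib-+; ∑-comm; *-distribˡ-sum; *-distribʳ-sum; sum-replicate-zero)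

  -- Stands in for trichotomy. Cotransitivity of apartness yields a side; if the resulting
  -- inequality points the wrong way, transitivity with `x < y` turns it into the other alternative.
  <-cotrans : ∀ {x y} → x < y → ∀ z → x < z ⊎ z < y
  <-cotrans x<y z with #-cotrans (<⇒# x<y) z
  ... | inj₁ x#z with #⇒<⊎> x#z
  ...   | inj₁ x<z = inj₁ x<z
  ...   | inj₂ z<x = inj₂ (<-trans z<x x<y)
  <-cotrans x<y z | inj₂ z#y with #⇒<⊎> z#y
  ...   | inj₁ z<y = inj₂ z<y
  ...   | inj₂ y<z = inj₁ (<-trans x<y y<z)

  <⇒≤ : ∀ {x y} → x < y → x ≤ y
  <⇒≤ = <-asym

  ≤-reflexive : ∀ {x y} → x ≈ y → x ≤ y
  ≤-reflexive x≈y = <-irrefl (sym x≈y)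

  ≤-refl : ∀ {x} → x ≤ x
  ≤-refl = ≤-reflexive refl

  <-≤-trans : ∀ {x y z} → x < y → y ≤ z → x < z
  <-≤-trans {z = z} x<y y≤z with <-cotrans x<y z
  ... | inj₁ x<z = x<z
  ... | inj₂ z<y = ⊥-elim (y≤z z<y)

  ≤-<-trans : ∀ {x y z} → x ≤ y → y < z → x < z
  ≤-<-trans {x} x≤y y<z with <-cotrans y<z x
  ... | inj₁ y<x = ⊥-elim (x≤y y<x)
  ... | inj₂ x<z = x<z

  ≤-trans : ∀ {x y z} → x ≤ y → y ≤ z → x ≤ z
  ≤-trans x≤y y≤z z<x = y≤z (<-≤-trans z<x x≤y)

  ≤-isPreorder : IsPreorder _≈_ _≤_
  ≤-isPreorder = record
    { isEquivalence = isEquivalence ; reflexive = ≤-reflexive ; trans = ≤-trans }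

  module ≤-Reasoning where
    open import Relation.Binary.Reasoning.Base.Triple
      ≤-isPreorder <-asym <-trans <-resp-≈ <⇒≤ <-≤-trans ≤-<-trans public

  ≤-resp : ∀ {x y z w} → x ≈ z → y ≈ w → x ≤ y → z ≤ w
  ≤-resp x≈z y≈w x≤y = ≤-trans (≤-reflexive (sym x≈z)) (≤-trans x≤y (≤-reflexive y≈w))

  -- Classical case analysis is available since ≤ is a negation.
  ≤-elim : ∀ {p} {P : Set p} {x y} → x ≤ y → (x < y → ¬ P) → (x ≈ y → ¬ P) → ¬ P
  ≤-elim {x = x} {y} x≤y lt eq p = eq (proj₁ (tight x y) x#y⇒⊥) p
    where
    x#y⇒⊥ : ¬ (x # y)
    x#y⇒⊥ x#y with #⇒<⊎> x#y
    ... | inj₁ x<y = lt x<y p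
    ... | inj₂ y<x = x≤y y<x

  0<y-x⇒x<y : ∀ {x y} → 0# < y - x → x < y
  0<y-x⇒x<y {x} {y} 0<y-x = <-respˡ-≈ (+-identityʳ x) $
    <-respʳ-≈ (solve 2 (λ x y → x :+ (y :- x) := y) refl x y) (+-monoʳ-< x 0<y-x)

  x<y⇒0<y-x : ∀ {x y} → x < y → 0# < y - x
  x<y⇒0<y-x {x} {y} x<y = <-respˡ-≈ (-‿inverseˡ x) $
    <-respʳ-≈ (+-comm (- x) y) (+-monoʳ-< (- x) x<y)

  0≤y-x⇒x≤y : ∀ {x y} → 0# ≤ y - x → x ≤ y
  0≤y-x⇒x≤y {x} {y} 0≤y-x y<x = 0≤y-x $
    <-respˡ-≈ (+-comm (- x) y) (<-respʳ-≈ (-‿inverseˡ x) (+-monoʳ-< (- x) y<x))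

  x≤y⇒0≤y-x : ∀ {x y} → x ≤ y → 0# ≤ y - x
  x≤y⇒0≤y-x {x} {y} x≤y y-x<0 = x≤y $
    <-respʳ-≈ (+-identityʳ x) $
    <-respˡ-≈ (solve 2 (λ x y → x :+ (y :- x) := y) refl x y) (+-monoʳ-< x y-x<0)

  +-monoʳ-≤ : ∀ z {x y} → x ≤ y → z + x ≤ z + y
  +-monoʳ-≤ z {x} {y} x≤y = 0≤y-x⇒x≤y $
    ≤-resp refl (solve 3 (λ x y z → y :- x := (z :+ y) :- (z :+ x)) refl x y z) (x≤y⇒0≤y-x x≤y)

  +-monoˡ-≤ : ∀ z {x y} → x ≤ y → x + z ≤ y + z
  +-monoˡ-≤ z x≤y = ≤-resp (+-comm _ _) (+-comm _ _) (+-monoʳ-≤ z x≤y)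

  +-mono-≤ : ∀ {x y z w} → x ≤ y → z ≤ w → x + z ≤ y + w
  +-mono-≤ x≤y z≤w = ≤-trans (+-monoˡ-≤ _ x≤y) (+-monoʳ-≤ _ z≤w)

  +-monoˡ-< : ∀ z {x y} → x < y → x + z < y + z
  +-monoˡ-< z x<y = <-respˡ-≈ (+-comm _ _) (<-respʳ-≈ (+-comm _ _) (+-monoʳ-< z x<y))

  +-nonneg : ∀ {x y} → 0# ≤ x → 0# ≤ y → 0# ≤ x + y
  +-nonneg 0≤x 0≤y = ≤-resp (+-identityˡ 0#) refl (+-mono-≤ 0≤x 0≤y)

  +-pos-nonneg : ∀ {x y} → 0# < x → 0# ≤ y → 0# < x + y
  +-pos-nonneg {x} 0<x 0≤y = <-≤-trans (<-respʳ-≈ (sym (+-identityʳ x)) 0<x) (+-monoʳ-≤ x 0≤y)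

  +-nonneg-pos : ∀ {x y} → 0# ≤ x → 0# < y → 0# < x + y
  +-nonneg-pos 0≤x 0<y = <-respʳ-≈ (+-comm _ _) (+-pos-nonneg 0<y 0≤x)

  0<x+y⇒0<x⊎0<y : ∀ {x y} → 0# < x + y → 0# < x ⊎ 0# < y
  0<x+y⇒0<x⊎0<y {x} {y} 0<x+y with <-cotrans 0<x+y x
  ... | inj₁ 0<x   = inj₁ 0<x
  ... | inj₂ x<x+y = inj₂ (<-respʳ-≈ (solve 2 (λ x y → x :+ y :- x := y) refl x y) (x<y⇒0<y-x x<x+y))

  *-nonneg : ∀ {x y} → 0# ≤ x → 0# ≤ y → 0# ≤ x * y
  *-nonneg 0≤x 0≤y =
    ≤-elim 0≤x
      (λ 0<x → ≤-elim 0≤y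
        (λ 0<y → <⇒≤ (*-pos 0<x 0<y))
        (λ 0≈y → ≤-reflexive (sym (trans (*-congˡ (sym 0≈y)) (zeroʳ _)))))
      (λ 0≈x → ≤-reflexive (sym (trans (*-congʳ (sym 0≈x)) (zeroˡ _))))

  *-monoˡ-≤ : ∀ {z x y} → 0# ≤ z → x ≤ y → z * x ≤ z * y
  *-monoˡ-≤ {z} {x} {y} 0≤z x≤y = 0≤y-x⇒x≤y $
    ≤-resp refl (solve 3 (λ x y z → z :* (y :- x) := z :* y :- z :* x) refl x y z)
      (*-nonneg 0≤z (x≤y⇒0≤y-x x≤y))

  *-monoˡ-< : ∀ {z x y} → 0# < z → x < y → z * x < z * y
  *-monoˡ-< {z} {x} {y} 0<z x<y = 0<y-x⇒x<y $
    <-respʳ-≈ (solve 3 (λ x y z → z :* (y :- x) := z :* y :- z :* x) refl x y z)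
      (*-pos 0<z (x<y⇒0<y-x x<y))

  x<0⇒0<-x : ∀ {x} → x < 0# → 0# < - x
  x<0⇒0<-x {x} x<0 = <-respʳ-≈ (+-identityˡ (- x)) (x<y⇒0<y-x x<0)

  #0⇒0<x² : ∀ {x} → x # 0# → 0# < x * x
  #0⇒0<x² {x} x#0 with #⇒<⊎> x#0
  ... | inj₁ x<0 = <-respʳ-≈ (solve 1 (λ x → :- x :* :- x := x :* x) refl x) (*-pos (x<0⇒0<-x x<0) (x<0⇒0<-x x<0))
  ... | inj₂ 0<x = *-pos 0<x 0<x

  xy#0⇒x#0 : ∀ {x y} → x * y # 0# → x # 0#
  xy#0⇒x#0 {x} {y} xy#0 with #⇒invertible xy#0
  ... | v , _ , xyv≈1 = invertibleʳ⇒# (y * v , (begin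
    (x - 0#) * (y * v)   ≈⟨ solve 3 (λ x y v → (x :- :0) :* (y :* v) := (x :* y :- :0) :* v) refl x y v ⟩
    (x * y - 0#) * v     ≈⟨ xyv≈1 ⟩
    1#                   ∎))

  -- The sign of x cannot be decided, but `≤` is a negation: if x² < 0 then x is apart from 0, and
  -- x² is positive after all.
  0≤x² : ∀ x → 0# ≤ x * x
  0≤x² x x²<0 = <-asym x²<0 (#0⇒0<x² (xy#0⇒x#0 (<⇒# x²<0)))

  -- A factor of a product apart from 0 is itself apart from 0, so x has a strict sign, and `0 ≤ x`
  -- excludes the negative one.
  0<xy∧0≤x⇒0<x : ∀ {x y} → 0# < x * y → 0# ≤ x → 0# < x
  0<xy∧0≤x⇒0<x 0<xy 0≤x =
    [ (λ x<0 → ⊥-elim (0≤x x<0)) , (λ 0<x → 0<x) ]′ (#⇒<⊎> (xy#0⇒x#0 (#-sym (<⇒# 0<xy))))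

  0<x∧0<xy⇒0<y : ∀ {x y} → 0# < x → 0# < x * y → 0# < y
  0<x∧0<xy⇒0<y {x} {y} 0<x 0<xy =
    0<xy∧0≤x⇒0<x {y} {x} (<-respʳ-≈ (*-comm x y) 0<xy) 0≤y
    where
    0≤y : 0# ≤ y
    0≤y y<0 = +-pos-nonneg 0<xy (<⇒≤ (*-pos 0<x (x<0⇒0<-x y<0)))
      |> <-respʳ-≈ (solve 2 (λ x y → x :* y :+ x :* :- y := :0) refl x y)
      |> <-irrefl {0#} {0#} refl

  *-cancelˡ-≤ : ∀ {z x y} → 0# < z → z * x ≤ z * y → x ≤ y
  *-cancelˡ-≤ 0<z zx≤zy y<x = zx≤zy (*-monoˡ-< 0<z y<x)

  *-cancelˡ-< : ∀ {z x y} → 0# < z → z * x < z * y → x < y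
  *-cancelˡ-< {z} {x} {y} 0<z zx<zy = 0<y-x⇒x<y $ 0<x∧0<xy⇒0<y 0<z $
    <-respʳ-≈ (solve 3 (λ x y z → z :* y :- z :* x := z :* (y :- x)) refl x y z) (x<y⇒0<y-x zx<zy)

  *-cancelˡ-≈ : ∀ {z x y} → z # 0# → z * x ≈ z * y → x ≈ y
  *-cancelˡ-≈ {z} {x} {y} z#0 zx≈zy with #⇒invertible z#0
  ... | v , vz≈1 , _ = begin
    x                   ≈⟨ *-identityˡ x ⟨
    1# * x              ≈⟨ *-congʳ vz≈1 ⟨
    v * (z - 0#) * x    ≈⟨ solve 3 (λ v z x → v :* (z :- :0) :* x := v :* (z :* x)) refl v z x ⟩
    v * (z * x)         ≈⟨ *-congˡ zx≈zy ⟩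
    v * (z * y)         ≈⟨ solve 3 (λ v z x → v :* (z :- :0) :* x := v :* (z :* x)) refl v z y ⟨
    v * (z - 0#) * y    ≈⟨ *-congʳ vz≈1 ⟩
    1# * y              ≈⟨ *-identityˡ y ⟩
    y                   ∎

  abstract
    reciprocal : ∀ {x} → 0# < x → ∃ λ y → 0# < y × x * y ≈ 1#
    reciprocal {x} 0<x with #⇒invertible (#-sym (<⇒# 0<x))
    ... | y , _ , [x-0]y≈1 = y , 0<x∧0<xy⇒0<y 0<x (<-respʳ-≈ (sym xy≈1) 0<1) , xy≈1
      where
      xy≈1 : x * y ≈ 1#
      xy≈1 = trans (*-congʳ (sym (x-0≈x x))) [x-0]y≈1

  sum-nonneg : ∀ {n} (f : Fin n → Carrier) → (∀ i → 0# ≤ f i) → 0# ≤ sum f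
  sum-nonneg {zero}  f 0≤f = ≤-refl
  sum-nonneg {suc n} f 0≤f = +-nonneg (0≤f fzero) (sum-nonneg (f ∘ fsuc) (0≤f ∘ fsuc))

  sum-mono-≤ : ∀ {n} (f g : Fin n → Carrier) → (∀ i → f i ≤ g i) → sum f ≤ sum g
  sum-mono-≤ {zero}  f g f≤g = ≤-refl
  sum-mono-≤ {suc n} f g f≤g = +-mono-≤ (f≤g fzero) (sum-mono-≤ (f ∘ fsuc) (g ∘ fsuc) (f≤g ∘ fsuc))

  sum-pos : ∀ {n} (f : Fin n → Carrier) → (∀ i → 0# ≤ f i) → ∀ i → 0# < f i → 0# < sum f
  sum-pos f 0≤f fzero    0<fi = +-pos-nonneg 0<fi (sum-nonneg (f ∘ fsuc) (0≤f ∘ fsuc))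
  sum-pos f 0≤f (fsuc i) 0<fi = +-nonneg-pos (0≤f fzero) (sum-pos (f ∘ fsuc) (0≤f ∘ fsuc) i 0<fi)

  -- This finds the edge of each step. Strictness is essential: cotransitivity can split
  -- `0 < x + y`, whereas a nonnegative sum would not single out a summand.
  sum-pos⇒∃ : ∀ {n} (f : Fin n → Carrier) → 0# < sum f → ∃ λ i → 0# < f i
  sum-pos⇒∃ {zero}  f 0<0 = ⊥-elim (<-irrefl refl 0<0)
  sum-pos⇒∃ {suc n} f 0<∑ with 0<x+y⇒0<x⊎0<y 0<∑
  ... | inj₁ 0<f₀ = fzero , 0<f₀
  ... | inj₂ 0<∑′ = let i , 0<fi = sum-pos⇒∃ (f ∘ fsuc) 0<∑′ in fsuc i , 0<fi

  sum-linear : ∀ {n} a (f g : Fin n → Carrier) → sum (λ i → f i + a * g i) ≈ sum f + a * sum g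
  sum-linear a f g = trans (∑-distrib-+ f (λ i → a * g i)) (+-congˡ (sym (*-distribˡ-sum a g)))

  δ : ∀ {n} → Fin n → Fin n → Carrier
  δ i j = if does (i ≟ j) then 1# else 0#

  sum-δ : ∀ {n} (i : Fin n) (f : Fin n → Carrier) → sum (λ j → δ i j * f j) ≈ f i
  sum-δ {suc n} fzero f = begin
    1# * f fzero + sum (λ j → 0# * f (fsuc j))  ≈⟨ +-cong (*-identityˡ _) (sum-cong-≋ (λ j → zeroˡ (f (fsuc j)))) ⟩
    f fzero + sum {n} (λ j → 0#)                ≈⟨ +-congˡ (sum-replicate-zero n) ⟩
    f fzero + 0#                                ≈⟨ +-identityʳ _ ⟩
    f fzero                                     ∎
  sum-δ {suc n} (fsuc i) f = begin
    0# * f fzero + sum (λ j → δ i j * f (fsuc j))  ≈⟨ +-cong (zeroˡ _) (sum-δ i (f ∘ fsuc)) ⟩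
    0# + f (fsuc i)                                ≈⟨ +-identityˡ _ ⟩
    f (fsuc i)                                     ∎

-- Solving positive definite systems by Schur complements.

module PositiveDefinite {c ℓ₁ ℓ₂} (ℝ : RealNumbers c ℓ₁ ℓ₂) where
  open GraphsOver ℝ
  open OrderedField ℝ
  open import Data.Vec.Functional using (_∷_)
  open import Relation.Binary.Reasoning.Setoid setoid

  Matrix : ℕ → Set c
  Matrix n = Fin n → Fin n → Carrier

  infixr 8 _·ᵥ_
  _·ᵥ_ : ∀ {n} → Matrix n → Vector Carrier n → Vector Carrier n
  (A ·ᵥ x) i = sum λ j → A i j * x j

  Symmetric : ∀ {n} → Matrix n → Set ℓ₁
  Symmetric A = ∀ i j → A i j ≈ A j i

  PositiveDefinite : ∀ {n} → Matrix n → Set (c ⊔ ℓ₂)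
  PositiveDefinite A = ∀ x → (∃ λ i → x i # 0#) → 0# < sum λ i → x i * (A ·ᵥ x) i

  module SchurComplement {n : ℕ} (A : Matrix (suc n)) (A-sym : Symmetric A) (A-posDef : PositiveDefinite A) where

    a : Carrier
    a = A fzero fzero

    0<a : 0# < a
    0<a = <-respʳ-≈ (begin
      sum (λ i → δ fzero i * (A ·ᵥ δ fzero) i)   ≈⟨ sum-δ fzero (A ·ᵥ δ fzero) ⟩
      sum (λ j → A fzero j * δ fzero j)          ≈⟨ sum-cong-≋ (λ j → *-comm (A fzero j) (δ fzero j)) ⟩
      sum (λ j → δ fzero j * A fzero j)          ≈⟨ sum-δ fzero (A fzero) ⟩
      a                                          ∎)
      (A-posDef (δ fzero) (fzero , #-sym (<⇒# 0<1)))

    v : Carrier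
    v = proj₁ (reciprocal 0<a)

    av≈1 : a * v ≈ 1#
    av≈1 = proj₂ (proj₂ (reciprocal 0<a))

    r : Vector Carrier n
    r i = A fzero (fsuc i)

    C S : Matrix n
    C i j = A (fsuc i) (fsuc j)
    S i j = C i j + - (v * r i) * r j

    S-sym : Symmetric S
    S-sym i j = +-cong (A-sym (fsuc i) (fsuc j))
      (solve 3 (λ v x y → :- (v :* x) :* y := :- (v :* y) :* x) refl v (r i) (r j))

    dot : Vector Carrier n → Carrier
    dot y = sum λ j → r j * y j

    S·ᵥ : ∀ y i → (S ·ᵥ y) i ≈ (C ·ᵥ y) i + - (v * r i) * dot y
    S·ᵥ y i = trans
      (sum-cong-≋ λ j → solve 4 (λ p q x y → (p :+ q :* x) :* y := p :* y :+ q :* (x :* y)) refl (C i j) (- (v * r i)) (r j) (y j))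
      (sum-linear (- (v * r i)) (λ j → C i j * y j) (λ j → r j * y j))

    A·ᵥ : ∀ x₀ y i → (A ·ᵥ (x₀ ∷ y)) (fsuc i) ≈ (S ·ᵥ y) i + v * r i * (a * x₀ + dot y)
    A·ᵥ x₀ y i = begin
      A (fsuc i) fzero * x₀ + (C ·ᵥ y) i
        ≈⟨ +-congʳ (*-congʳ (trans (A-sym (fsuc i) fzero) (sym (*-identityˡ (r i))))) ⟩
      1# * r i * x₀ + (C ·ᵥ y) i
        ≈⟨ +-congʳ (*-congʳ (*-congʳ av≈1)) ⟨
      a * v * r i * x₀ + (C ·ᵥ y) i
        ≈⟨ solve 6 (λ a v r x c d → a :* v :* r :* x :+ c := (c :+ :- (v :* r) :* d) :+ v :* r :* (a :* x :+ d)) refl a v (r i) x₀ ((C ·ᵥ y) i) (dot y) ⟩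
      ((C ·ᵥ y) i + - (v * r i) * dot y) + v * r i * (a * x₀ + dot y)
        ≈⟨ +-congʳ (S·ᵥ y i) ⟨
      (S ·ᵥ y) i + v * r i * (a * x₀ + dot y) ∎

    row₀ : ∀ z y → a * (v * (z - dot y)) + dot y ≈ z
    row₀ z y = begin
      a * (v * (z - dot y)) + dot y   ≈⟨ +-congʳ (*-assoc _ _ _) ⟨
      a * v * (z - dot y) + dot y     ≈⟨ +-congʳ (*-congʳ av≈1) ⟩
      1# * (z - dot y) + dot y        ≈⟨ solve 2 (λ z d → :1 :* (z :- d) :+ d := z) refl z (dot y) ⟩
      z                               ∎

    -- Completing the square in the first coordinate leaves the form of `S`; the hypothesis says
    -- that the completed square vanishes.
    form-A : ∀ x₀ y → a * x₀ + dot y ≈ 0# →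
      sum (λ i → (x₀ ∷ y) i * (A ·ᵥ (x₀ ∷ y)) i) ≈ sum (λ i → y i * (S ·ᵥ y) i)
    form-A x₀ y row≈0 = begin
      x₀ * (a * x₀ + dot y) + sum (λ i → y i * (A ·ᵥ (x₀ ∷ y)) (fsuc i))
        ≈⟨ +-cong (trans (*-congˡ row≈0) (zeroʳ x₀)) (sum-cong-≋ λ i → *-congˡ (row i)) ⟩
      0# + sum (λ i → y i * (S ·ᵥ y) i)
        ≈⟨ +-identityˡ _ ⟩
      sum (λ i → y i * (S ·ᵥ y) i) ∎
      where
      row : ∀ i → (A ·ᵥ (x₀ ∷ y)) (fsuc i) ≈ (S ·ᵥ y) i
      row i = begin
        (A ·ᵥ (x₀ ∷ y)) (fsuc i)                  ≈⟨ A·ᵥ x₀ y i ⟩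
        (S ·ᵥ y) i + v * r i * (a * x₀ + dot y)   ≈⟨ +-congˡ (trans (*-congˡ row≈0) (zeroʳ _)) ⟩
        (S ·ᵥ y) i + 0#                           ≈⟨ +-identityʳ _ ⟩
        (S ·ᵥ y) i                                ∎

    -- Extend y by the `x₀` that annihilates row 0; `form-A` then carries positivity from `A` to
    -- `S`.
    S-posDef : PositiveDefinite S
    S-posDef y (i , yᵢ#0) = <-respʳ-≈ (form-A x₀ y (row₀ 0# y)) (A-posDef (x₀ ∷ y) (fsuc i , yᵢ#0))
      where
      x₀ : Carrier
      x₀ = v * (0# - dot y)

    eliminated : Vector Carrier (suc n) → Vector Carrier n
    eliminated b i = b (fsuc i) - v * r i * b fzero

    back-substitute : ∀ b → (∃ λ y → ∀ i → (S ·ᵥ y) i ≈ eliminated b i) → ∃ λ x → ∀ i → (A ·ᵥ x) i ≈ b i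
    back-substitute b (y , Sy≈) = (x₀ ∷ y) , solves
      where
      x₀ : Carrier
      x₀ = v * (b fzero - dot y)

      solves : ∀ i → (A ·ᵥ (x₀ ∷ y)) i ≈ b i
      solves fzero    = row₀ (b fzero) y
      solves (fsuc i) = begin
        (A ·ᵥ (x₀ ∷ y)) (fsuc i)                    ≈⟨ A·ᵥ x₀ y i ⟩
        (S ·ᵥ y) i + v * r i * (a * x₀ + dot y)     ≈⟨ +-cong (Sy≈ i) (*-congˡ (row₀ (b fzero) y)) ⟩
        eliminated b i + v * r i * b fzero          ≈⟨ solve 2 (λ x y → (x :- y) :+ y := x) refl (b (fsuc i)) (v * r i * b fzero) ⟩
        b (fsuc i)                                  ∎

  -- Gaussian elimination without pivoting. The pivot is the value of the form at a unit vector,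
  -- hence positive and invertible; searching for a nonzero entry would require a decision.
  posDef⇒solvable : ∀ {n} (A : Matrix n) → Symmetric A → PositiveDefinite A →
    ∀ (b : Vector Carrier n) → ∃ λ x → ∀ i → (A ·ᵥ x) i ≈ b i
  posDef⇒solvable {zero}  A A-sym A-posDef b = (λ ()) , λ ()
  posDef⇒solvable {suc n} A A-sym A-posDef b =
    back-substitute b (posDef⇒solvable S S-sym S-posDef (eliminated b))
    where open SchurComplement A A-sym A-posDef

-- Forms that are weighted sums of squares of functionals.

module WeightedForms {c ℓ₁ ℓ₂} (ℝ : RealNumbers c ℓ₁ ℓ₂) where
  open GraphsOver ℝ
  open OrderedField ℝ
  open PositiveDefinite ℝ
  open import Relation.Binary.Reasoning.Setoid setoid

  infix 6 _+[_]_
  _+[_]_ : ∀ {n} → Vector Carrier n → Carrier → Vector Carrier n → Vector Carrier n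
  (x +[ a ] y) i = x i + a * y i

  module Forms {N K : ℕ} (b : Fin K → Vector Carrier N) where

    V : Set c
    V = Vector Carrier N

    f : Fin K → V → Carrier
    f e x = sum λ i → b e i * x i

    f-linear : ∀ e x a y → f e (x +[ a ] y) ≈ f e x + a * f e y
    f-linear e x a y = trans
      (sum-cong-≋ λ i → solve 4 (λ b x a y → b :* (x :+ a :* y) := b :* x :+ a :* (b :* y)) refl (b e i) (x i) a (y i))
      (sum-linear a (λ i → b e i * x i) (λ i → b e i * y i))

    -- The coefficients carry no sign condition, because the barriers are differences of weighted
    -- sums; nonnegativity is the separate predicate `PSD`.
    form : Vector Carrier K → V → V → Carrier
    form c x y = sum λ e → c e * (f e x * f e y)

    form-cong : ∀ {c c′} → (∀ e → c e ≈ c′ e) → ∀ x y → form c x y ≈ form c′ x y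
    form-cong c≈c′ x y = sum-cong-≋ λ e → *-congʳ (c≈c′ e)

    form-sym : ∀ c x y → form c x y ≈ form c y x
    form-sym c x y = sum-cong-≋ λ e → *-congˡ (*-comm (f e x) (f e y))

    form-linearˡ : ∀ c x a z y → form c (x +[ a ] z) y ≈ form c x y + a * form c z y
    form-linearˡ c x a z y = trans
      (sum-cong-≋ λ e → trans (*-congˡ (*-congʳ (f-linear e x a z)))
        (solve 5 (λ c x a z y → c :* ((x :+ a :* z) :* y) := c :* (x :* y) :+ a :* (c :* (z :* y))) refl (c e) (f e x) a (f e z) (f e y)))
      (sum-linear a (λ e → c e * (f e x * f e y)) (λ e → c e * (f e z * f e y)))

    form-linear-coeff : ∀ c a c′ x y → form (c +[ a ] c′) x y ≈ form c x y + a * form c′ x y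
    form-linear-coeff c a c′ x y = trans
      (sum-cong-≋ λ e → solve 4 (λ c a d z → (c :+ a :* d) :* z := c :* z :+ a :* (d :* z)) refl (c e) a (c′ e) (f e x * f e y))
      (sum-linear a (λ e → c e * (f e x * f e y)) (λ e → c′ e * (f e x * f e y)))

    form-δ : ∀ e x y → form (δ e) x y ≈ f e x * f e y
    form-δ e x y = sum-δ e (λ e → f e x * f e y)

    form-expand : ∀ c x a y →
      form c (x +[ a ] y) (x +[ a ] y) ≈ form c x x + (a + a) * form c x y + a * a * form c y y
    form-expand c x a y = begin
      form c (x +[ a ] y) (x +[ a ] y)
        ≈⟨ form-linearˡ c x a y (x +[ a ] y) ⟩
      form c x (x +[ a ] y) + a * form c y (x +[ a ] y)
        ≈⟨ +-cong (half x) (*-congˡ (half y)) ⟩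
      (form c x x + a * form c y x) + a * (form c x y + a * form c y y)
        ≈⟨ +-congʳ (+-congˡ (*-congˡ (form-sym c y x))) ⟩
      (form c x x + a * form c x y) + a * (form c x y + a * form c y y)
        ≈⟨ solve 4 (λ X Z Y a → (X :+ a :* Z) :+ a :* (Z :+ a :* Y) := X :+ (a :+ a) :* Z :+ a :* a :* Y) refl (form c x x) (form c x y) (form c y y) a ⟩
      form c x x + (a + a) * form c x y + a * a * form c y y ∎
      where
      half : ∀ z → form c z (x +[ a ] y) ≈ form c x z + a * form c y z
      half z = trans (form-sym c z (x +[ a ] y)) (form-linearˡ c x a y z)

    PSD : Vector Carrier K → Set (c ⊔ ℓ₂)
    PSD c = ∀ x → 0# ≤ form c x x

    nonneg⇒PSD : ∀ c → (∀ e → 0# ≤ c e) → PSD c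
    nonneg⇒PSD c 0≤c x = sum-nonneg (λ e → c e * (f e x * f e x)) (λ e → *-nonneg (0≤c e) (0≤x² (f e x)))

    -- The form at y + a x is a nonnegative quadratic polynomial in a. If X > 0 it is evaluated at
    -- its minimum; if X = 0 it is linear in a, so its slope cannot be apart from 0. The case
    -- distinction is legitimate because the conclusion is a negation.
    Cauchy–Schwarz : ∀ c → PSD c → ∀ x y → form c x y * form c x y ≤ form c x x * form c y y
    Cauchy–Schwarz c psd x y = ≤-elim (psd x) case-pos case-zero
      where
      X Y Z : Carrier
      X = form c x x
      Y = form c y y
      Z = form c x y

      discriminant : ∀ a → 0# ≤ Y + (a + a) * Z + a * a * X
      discriminant a = ≤-resp refl (trans (form-expand c y a x) (+-congʳ (+-congˡ (*-congˡ (form-sym c y x))))) (psd (y +[ a ] x))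

      case-pos : 0# < X → ¬ (X * Y < Z * Z)
      case-pos 0<X XY<Z² = 0≤XY-Z² XY-Z²<0
        where
        v : Carrier
        v = proj₁ (reciprocal 0<X)
        Xv≈1 : X * v ≈ 1#
        Xv≈1 = proj₂ (proj₂ (reciprocal 0<X))
        0≤XY-Z² : 0# ≤ X * Y - Z * Z
        0≤XY-Z² = ≤-resp (zeroʳ X) (begin
          X * (Y + (- (Z * v) + - (Z * v)) * Z + - (Z * v) * - (Z * v) * X)
            ≈⟨ solve 4 (λ X Y Z v → X :* (Y :+ (:- (Z :* v) :+ :- (Z :* v)) :* Z :+ :- (Z :* v) :* :- (Z :* v) :* X)
                 := X :* Y :- Z :* Z :* (X :* v) :+ Z :* Z :* (X :* v) :* (X :* v :- :1)) refl X Y Z v ⟩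
          X * Y - Z * Z * (X * v) + Z * Z * (X * v) * (X * v - 1#)
            ≈⟨ +-cong (+-congˡ (-‿cong (*-congˡ Xv≈1))) (*-cong (*-congˡ Xv≈1) (+-congʳ Xv≈1)) ⟩
          X * Y - Z * Z * 1# + Z * Z * 1# * (1# - 1#)
            ≈⟨ solve 3 (λ X Y Z → X :* Y :- Z :* Z :* :1 :+ Z :* Z :* :1 :* (:1 :- :1) := X :* Y :- Z :* Z) refl X Y Z ⟩
          X * Y - Z * Z ∎)
          (*-monoˡ-≤ (<⇒≤ 0<X) (discriminant (- (Z * v))))
        XY-Z²<0 : X * Y - Z * Z < 0#
        XY-Z²<0 = <-respʳ-≈ (-‿inverseʳ (Z * Z)) (+-monoˡ-< (- (Z * Z)) XY<Z²)

      case-zero : 0# ≈ X → ¬ (X * Y < Z * Z)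
      case-zero 0≈X XY<Z² = contradiction
        where
        0<Z² : 0# < Z * Z
        0<Z² = <-respˡ-≈ (trans (*-congʳ (sym 0≈X)) (zeroˡ Y)) XY<Z²
        v : Carrier
        v = proj₁ (reciprocal 0<Z²)
        -- With Z² k = Y + 1 the linear polynomial takes the value -(Y + 2) at a = -Z k, which is
        -- negative since Y ≥ 0.
        k : Carrier
        k = (Y + 1#) * v
        Z²k : Z * Z * k ≈ Y + 1#
        Z²k = trans (solve 3 (λ z y v → z :* (y :* v) := y :* (z :* v)) refl (Z * Z) (Y + 1#) v)
          (trans (*-congˡ (proj₂ (proj₂ (reciprocal 0<Z²)))) (*-identityʳ _))
        contradiction : ⊥
        contradiction = ≤-resp refl (begin
          Y + (- (Z * k) + - (Z * k)) * Z + - (Z * k) * - (Z * k) * X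
            ≈⟨ +-congˡ (*-congˡ (sym 0≈X)) ⟩
          Y + (- (Z * k) + - (Z * k)) * Z + - (Z * k) * - (Z * k) * 0#
            ≈⟨ solve 3 (λ Y Z k → Y :+ (:- (Z :* k) :+ :- (Z :* k)) :* Z :+ :- (Z :* k) :* :- (Z :* k) :* :0
                 := Y :- Z :* Z :* k :- Z :* Z :* k) refl Y Z k ⟩
          Y - Z * Z * k - Z * Z * k
            ≈⟨ +-cong (+-congˡ (-‿cong Z²k)) (-‿cong Z²k) ⟩
          Y - (Y + 1#) - (Y + 1#)
            ≈⟨ solve 1 (λ Y → Y :- (Y :+ :1) :- (Y :+ :1) := :0 :- (Y :+ :1 :+ :1)) refl Y ⟩
          0# - (Y + 1# + 1#) ∎)
          (discriminant (- (Z * k)))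
          (<-respʳ-≈ (-‿inverseʳ _) (+-monoˡ-< (- (Y + 1# + 1#)) (+-nonneg-pos (+-nonneg (psd y) (<⇒≤ 0<1)) 0<1)))

    gram : Vector Carrier K → Matrix N
    gram c i j = sum λ e → c e * (b e i * b e j)

    gram-·ᵥ : ∀ c x i → (gram c ·ᵥ x) i ≈ sum λ e → c e * (b e i * f e x)
    gram-·ᵥ c x i = begin
      sum (λ j → sum (λ e → c e * (b e i * b e j)) * x j)
        ≈⟨ sum-cong-≋ (λ j → *-distribʳ-sum (x j) (λ e → c e * (b e i * b e j))) ⟩
      sum (λ j → sum λ e → c e * (b e i * b e j) * x j)
        ≈⟨ ∑-comm (λ j e → c e * (b e i * b e j) * x j) ⟩
      sum (λ e → sum λ j → c e * (b e i * b e j) * x j)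
        ≈⟨ sum-cong-≋ (λ e → sum-cong-≋ λ j → solve 4 (λ c p q x → c :* (p :* q) :* x := c :* p :* (q :* x)) refl (c e) (b e i) (b e j) (x j)) ⟩
      sum (λ e → sum λ j → c e * b e i * (b e j * x j))
        ≈⟨ sum-cong-≋ (λ e → sym (*-distribˡ-sum (c e * b e i) (λ j → b e j * x j))) ⟩
      sum (λ e → c e * b e i * f e x)
        ≈⟨ sum-cong-≋ (λ e → *-assoc (c e) (b e i) (f e x)) ⟩
      sum (λ e → c e * (b e i * f e x)) ∎

    form-gram : ∀ c x y → form c x y ≈ sum λ i → y i * (gram c ·ᵥ x) i
    form-gram c x y = begin
      sum (λ e → c e * (f e x * f e y))
        ≈⟨ sum-cong-≋ (λ e → trans (sym (*-assoc (c e) (f e x) (f e y))) (*-distribˡ-sum (c e * f e x) (λ i → b e i * y i))) ⟩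
      sum (λ e → sum λ i → c e * f e x * (b e i * y i))
        ≈⟨ ∑-comm (λ e i → c e * f e x * (b e i * y i)) ⟩
      sum (λ i → sum λ e → c e * f e x * (b e i * y i))
        ≈⟨ sum-cong-≋ (λ i → sum-cong-≋ λ e → solve 4 (λ c f b y → c :* f :* (b :* y) := y :* (c :* (b :* f))) refl (c e) (f e x) (b e i) (y i)) ⟩
      sum (λ i → sum λ e → y i * (c e * (b e i * f e x)))
        ≈⟨ sum-cong-≋ (λ i → sym (*-distribˡ-sum (y i) (λ e → c e * (b e i * f e x)))) ⟩
      sum (λ i → y i * sum λ e → c e * (b e i * f e x))
        ≈⟨ sum-cong-≋ (λ i → *-congˡ (sym (gram-·ᵥ c x i))) ⟩
      sum (λ i → y i * (gram c ·ᵥ x) i) ∎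

    Definite : Vector Carrier K → Set (c ⊔ ℓ₂)
    Definite c = ∀ x → (∃ λ i → x i # 0#) → 0# < form c x x

    -- The Riesz vector of the functional with coordinates g; it replaces an inverse matrix applied
    -- to g.
    representable : ∀ c → Definite c → ∀ (g : V) → ∃ λ x → ∀ y → form c x y ≈ sum λ i → y i * g i
    representable c def g = x , λ y → trans (form-gram c x y) (sum-cong-≋ λ i → *-congˡ (x-solves i))
      where
      solution : ∃ λ x → ∀ i → (gram c ·ᵥ x) i ≈ g i
      solution = posDef⇒solvable (gram c)
        (λ i j → sum-cong-≋ λ e → *-congˡ (*-comm (b e i) (b e j)))
        (λ x x#0 → <-respʳ-≈ (form-gram c x x) (def x x#0)) g
      x : V
      x = proj₁ solution
      x-solves : ∀ i → (gram c ·ᵥ x) i ≈ g i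
      x-solves = proj₂ solution

-- Potentials, shifts of a barrier and rank-one updates.

module Barriers {c₀ ℓ₁ ℓ₂} (ℝ : RealNumbers c₀ ℓ₁ ℓ₂) where
  open GraphsOver ℝ
  open OrderedField ℝ
  open WeightedForms ℝ

  module Weighted {N K : ℕ} (b : Fin K → Vector Carrier N) (w : Vector Carrier K) (0≤w : ∀ e → 0# ≤ w e) where
    open Forms b public

    M : V → V → Carrier
    M = form w

    M-psd : PSD w
    M-psd = nonneg⇒PSD w 0≤w

    potential : (Fin K → V) → Carrier
    potential p = sum λ e → w e * f e (p e)

    Solves : Vector Carrier K → (Fin K → V) → Set (c₀ ⊔ ℓ₁)
    Solves c p = ∀ e y → form c (p e) y ≈ f e y

    -- The potential of c is the trace Tr (L⁻¹M), L being the matrix of form c.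
    record Barrier (c : Vector Carrier K) (ε : Carrier) : Set (c₀ ⊔ ℓ₁ ⊔ ℓ₂) where
      field
        psd    : PSD c
        sol    : Fin K → V
        solves : Solves c sol
        bound  : potential sol ≤ ε

    -- When p and q solve forms with matrices L and L′, this is the trace Tr (L⁻¹M L′⁻¹M), which
    -- governs how a shift of the barrier changes the potential.
    M-pairing : (p q : Fin K → V) → Carrier
    M-pairing p q = sum λ e → w e * M (p e) (q e)

    weighted-mono : ∀ (g h : Vector Carrier K) → (∀ e → g e ≤ h e) → sum (λ e → w e * g e) ≤ sum (λ e → w e * h e)
    weighted-mono g h g≤h = sum-mono-≤ (λ e → w e * g e) (λ e → w e * h e) (λ e → *-monoˡ-≤ (0≤w e) (g≤h e))

    weighted-linear : ∀ (g : Vector Carrier K) a h → sum (λ e → w e * (g +[ a ] h) e) ≈ sum (λ e → w e * g e) + a * sum (λ e → w e * h e)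
    weighted-linear g a h = trans
      (sum-cong-≋ λ e → solve 4 (λ w g a h → w :* (g :+ a :* h) := w :* g :+ a :* (w :* h)) refl (w e) (g e) a (h e))
      (sum-linear a (λ e → w e * g e) (λ e → w e * h e))

    -- Cauchy-Schwarz for the form of `c`, with one argument the vector `p e` that represents `f e`.
    f²≤ : ∀ c p → PSD c → Solves c p → ∀ e x → f e x * f e x ≤ f e (p e) * form c x x
    f²≤ c p psd solves e x =
      ≤-resp (*-cong (solves e x) (solves e x)) (*-congʳ (solves e (p e))) (Cauchy–Schwarz c psd (p e) x)

    -- The weighted sum of `f²≤` over all edges. It replaces the bound of the largest eigenvalue of
    -- L⁻¹M by its trace.
    M≤potential : ∀ c p → PSD c → Solves c p → ∀ x → M x x ≤ potential p * form c x x
    M≤potential c p psd solves x = begin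
      M x x                                              ≤⟨ weighted-mono _ _ (λ e → f²≤ c p psd solves e x) ⟩
      sum (λ e → w e * (f e (p e) * form c x x))         ≈⟨ sum-cong-≋ (λ e → sym (*-assoc (w e) (f e (p e)) (form c x x))) ⟩
      sum (λ e → w e * f e (p e) * form c x x)           ≈⟨ *-distribʳ-sum (form c x x) (λ e → w e * f e (p e)) ⟨
      potential p * form c x x                           ∎
      where open ≤-Reasoning

    -- Serves both barriers, with `p` always belonging to the smaller form. On the upper side `p` is
    -- the old family and `q` the new one; on the lower side, where advancing the barrier shrinks
    -- the form, it is the other way round.
    module Shift (c c′ : Vector Carrier K) (d : Carrier) (0<d : 0# < d) (form-shift : ∀ x y → form c′ x y ≈ form c x y + d * M x y) (psd : PSD c) (p q : Fin K → V) (p-solves : Solves c p) (q-solves : Solves c′ q) where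
      open import Relation.Binary.Reasoning.Setoid setoid

      psd′ : PSD c′
      psd′ x = ≤-resp refl (sym (form-shift x x)) (+-nonneg (psd x) (*-nonneg (<⇒≤ 0<d) (M-psd x)))

      -- The resolvent identity L⁻¹ - L′⁻¹ = d L⁻¹ M L′⁻¹, read at the functional of `e`.
      difference : ∀ e → f e (p e) ≈ f e (q e) + d * M (p e) (q e)
      difference e = begin
        f e (p e)                                ≈⟨ q-solves e (p e) ⟨
        form c′ (q e) (p e)                      ≈⟨ form-sym c′ (q e) (p e) ⟩
        form c′ (p e) (q e)                      ≈⟨ form-shift (p e) (q e) ⟩
        form c (p e) (q e) + d * M (p e) (q e)   ≈⟨ +-congʳ (p-solves e (q e)) ⟩
        f e (q e) + d * M (p e) (q e)            ∎

      potential-difference : potential p ≈ potential q + d * M-pairing p q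
      potential-difference = trans (sum-cong-≋ λ e → *-congˡ (difference e))
        (weighted-linear (λ e → f e (q e)) d (λ e → M (p e) (q e)))

      -- The form of `c` at p e - q e is nonnegative and works out to d times the difference of the
      -- two sides.
      M-qq≤M-pq : ∀ e → M (q e) (q e) ≤ M (p e) (q e)
      M-qq≤M-pq e = 0≤y-x⇒x≤y (*-cancelˡ-≤ 0<d (≤-resp (sym (zeroʳ d)) eq (psd (p e +[ - 1# ] q e))))
        where
        x = f e (q e)
        m = M (p e) (q e)
        m′ = M (q e) (q e)
        form-c-qq : form c (q e) (q e) ≈ x - d * m′
        form-c-qq = begin
          form c (q e) (q e)                           ≈⟨ solve 2 (λ y z → y := (y :+ z) :- z) refl _ (d * m′) ⟩
          (form c (q e) (q e) + d * m′) - d * m′       ≈⟨ +-congʳ (form-shift (q e) (q e)) ⟨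
          form c′ (q e) (q e) - d * m′                 ≈⟨ +-congʳ (q-solves e (q e)) ⟩
          x - d * m′                                   ∎
        eq : form c (p e +[ - 1# ] q e) (p e +[ - 1# ] q e) ≈ d * (m - m′)
        eq = begin
          form c (p e +[ - 1# ] q e) (p e +[ - 1# ] q e)
            ≈⟨ form-expand c (p e) (- 1#) (q e) ⟩
          form c (p e) (p e) + (- 1# + - 1#) * form c (p e) (q e) + - 1# * - 1# * form c (q e) (q e)
            ≈⟨ +-cong (+-cong (trans (p-solves e (p e)) (difference e)) (*-congˡ (p-solves e (q e)))) (*-congˡ form-c-qq) ⟩
          (x + d * m) + (- 1# + - 1#) * x + - 1# * - 1# * (x - d * m′)
            ≈⟨ solve 4 (λ x d m m′ → (x :+ d :* m) :+ (:- :1 :+ :- :1) :* x :+ :- :1 :* :- :1 :* (x :- d :* m′) := d :* (m :- m′)) refl x d m m′ ⟩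
          d * (m - m′) ∎

      M-pairing-qq≤pq : M-pairing q q ≤ M-pairing p q
      M-pairing-qq≤pq = weighted-mono (λ e → M (q e) (q e)) (λ e → M (p e) (q e)) M-qq≤M-pq

      f-q-nonneg : ∀ e → 0# ≤ f e (q e)
      f-q-nonneg e = ≤-resp refl (q-solves e (q e)) (psd′ (q e))

      -- One edge suffices: by `f²≤`, a vector y on which `f e` does not vanish forces f e (q e) >
      -- 0, and the square of this number enters M (q e) (q e) with weight `w e`.
      M-pairing-pos : ∀ e y → 0# < w e → 0# < f e y * f e y → 0# < M-pairing p q
      M-pairing-pos e y 0<w 0<f² = <-≤-trans
        (sum-pos (λ e → w e * M (q e) (q e)) (λ e → *-nonneg (0≤w e) (M-psd (q e))) e
          (*-pos 0<w (sum-pos (λ e′ → w e′ * (f e′ (q e) * f e′ (q e))) (λ e′ → *-nonneg (0≤w e′) (0≤x² _)) e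
            (*-pos 0<w (*-pos 0<f 0<f)))))
        M-pairing-qq≤pq
        where
        0<f : 0# < f e (q e)
        0<f = 0<xy∧0≤x⇒0<x
          (<-≤-trans 0<f² (f²≤ c′ q psd′ q-solves e y))
          (f-q-nonneg e)

      -- The form c′ is nonnegative at p - (1 + τ) q.
      M-pairing-pp : ∀ τ → (1# + τ + τ) * potential p ≤ d * M-pairing p p + (1# + τ) * (1# + τ) * potential q
      M-pairing-pp τ = 0≤y-x⇒x≤y (≤-resp refl (trans (weighted-sum) rearrange) (sum-nonneg (λ e → w e * nn e) (λ e → *-nonneg (0≤w e) (nn-nonneg e))))
        where
        s = 1# + τ
        P Q R nn : Vector Carrier K
        P e = f e (p e)
        Q e = f e (q e)
        R e = M (p e) (p e)
        nn = ((P +[ d ] R) +[ - s + - s ] P) +[ s * s ] Q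
        nn-nonneg : ∀ e → 0# ≤ nn e
        nn-nonneg e = ≤-resp refl (begin
          form c′ (p e +[ - s ] q e) (p e +[ - s ] q e)
            ≈⟨ form-expand c′ (p e) (- s) (q e) ⟩
          form c′ (p e) (p e) + (- s + - s) * form c′ (p e) (q e) + - s * - s * form c′ (q e) (q e)
            ≈⟨ +-cong (+-cong (trans (form-shift (p e) (p e)) (+-congʳ (p-solves e (p e))))
                 (*-congˡ (trans (form-sym c′ (p e) (q e)) (q-solves e (p e)))))
                 (*-cong (solve 1 (λ s → :- s :* :- s := s :* s) refl s) (q-solves e (q e))) ⟩
          nn e ∎)
          (psd′ (p e +[ - s ] q e))
        weighted-sum : sum (λ e → w e * nn e) ≈ ((potential p + d * M-pairing p p) + (- s + - s) * potential p) + s * s * potential q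
        weighted-sum = trans (weighted-linear ((P +[ d ] R) +[ - s + - s ] P) (s * s) Q)
          (+-congʳ (trans (weighted-linear (P +[ d ] R) (- s + - s) P) (+-congʳ (weighted-linear P d R))))
        rearrange : ((potential p + d * M-pairing p p) + (- s + - s) * potential p) + s * s * potential q
          ≈ (d * M-pairing p p + s * s * potential q) - (1# + τ + τ) * potential p
        rearrange = solve 4 (λ P T Q τ → ((P :+ T) :+ (:- (:1 :+ τ) :+ :- (:1 :+ τ)) :* P) :+ (:1 :+ τ) :* (:1 :+ τ) :* Q
          := (T :+ (:1 :+ τ) :* (:1 :+ τ) :* Q) :- (:1 :+ τ :+ τ) :* P) refl (potential p) (d * M-pairing p p) (potential q) τ

    -- `s` is -t / (1 + t φ) with the denominator cleared, φ being f e₀ (p e₀). The sign of `t` is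
    -- left open: the update lowers the upper form and raises the lower one.
    module ShermanMorrison (c : Vector Carrier K) (p : Fin K → V) (solves : Solves c p) (e₀ : Fin K) (t s : Carrier) (s-eq : s * (1# + t * f e₀ (p e₀)) ≈ - t) where
      open import Relation.Binary.Reasoning.Setoid setoid

      updated : Fin K → V
      updated e = p e +[ s * f e (p e₀) ] p e₀

      updated-solves : Solves (c +[ t ] δ e₀) updated
      updated-solves e y = begin
        form (c +[ t ] δ e₀) (updated e) y
          ≈⟨ trans (form-linear-coeff c t (δ e₀) (updated e) y) (+-congˡ (*-congˡ (form-δ e₀ (updated e) y))) ⟩
        form c (updated e) y + t * (f e₀ (updated e) * f e₀ y)
          ≈⟨ +-cong (trans (form-linearˡ c (p e) a (p e₀) y) (+-cong (solves e y) (*-congˡ (solves e₀ y))))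
               (*-congˡ (*-congʳ (trans (f-linear e₀ (p e) a (p e₀)) (+-congʳ reciprocity)))) ⟩
        (f e y + a * f e₀ y) + t * ((g + a * φ) * f e₀ y)
          ≈⟨ solve 6 (λ x y s g t φ → (x :+ s :* g :* y) :+ t :* ((g :+ s :* g :* φ) :* y) := x :+ (s :* (:1 :+ t :* φ) :+ t) :* (g :* y)) refl (f e y) (f e₀ y) s g t φ ⟩
        f e y + (s * (1# + t * φ) + t) * (g * f e₀ y)
          ≈⟨ +-congˡ (*-congʳ (trans (+-congʳ s-eq) (-‿inverseˡ t))) ⟩
        f e y + 0# * (g * f e₀ y)
          ≈⟨ trans (+-congˡ (zeroˡ _)) (+-identityʳ _) ⟩
        f e y ∎
        where
        g = f e (p e₀)
        a = s * g
        φ = f e₀ (p e₀)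
        reciprocity : f e₀ (p e) ≈ g
        reciprocity = trans (sym (solves e₀ (p e))) (trans (form-sym c (p e₀) (p e)) (solves e (p e₀)))

      updated-potential : potential updated ≈ potential p + s * M (p e₀) (p e₀)
      updated-potential = trans
        (sum-cong-≋ λ e → *-congˡ (trans (f-linear e (p e) (s * f e (p e₀)) (p e₀)) (+-congˡ (*-assoc s _ _))))
        (weighted-linear (λ e → f e (p e)) s (λ e → f e (p e₀) * f e (p e₀)))

-- One step of the two-barrier iteration.

module Steps {c₀ ℓ₁ ℓ₂} (ℝ : RealNumbers c₀ ℓ₁ ℓ₂) where
  open GraphsOver ℝ
  open OrderedField ℝ
  open WeightedForms ℝ
  open Barriers ℝ

  module Definite {N K : ℕ} (b : Fin K → Vector Carrier N) (w : Vector Carrier K) (0≤w : ∀ e → 0# ≤ w e) (w-def : Forms.Definite b w) where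
    open Weighted b w 0≤w public

    solvable : ∀ c η → 0# < η → (∀ x → η * M x x ≤ form c x x) → ∃ λ p → Solves c p
    solvable c η 0<η ηM≤ = (λ e → proj₁ (rep e)) , λ e y →
      trans (proj₂ (rep e) y) (sum-cong-≋ λ i → *-comm (y i) (b e i))
      where
      rep : ∀ e → ∃ λ x → ∀ y → form c x y ≈ sum λ i → y i * b e i
      rep e = representable c (λ x x#0 → <-≤-trans (*-pos 0<η (w-def x x#0)) (ηM≤ x)) (b e)

    -- `balance` reads 1/d + εᵁ = 1 - εᴸ: just enough for the weighted sum of the upper quantities
    -- U_A(e) to stay below that of the lower ones L_A(e) when the barriers advance by d and 1. The
    -- edge `e₁` and the vector `y₁` certify that both potentials change strictly.
    module Step (cᵁ cᴸ : Vector Carrier K) (εᵁ εᴸ d σ : Carrier) (0<d : 0# < d) (εᴸ<1 : εᴸ < 1#) (1<σ : 1# < σ) (σεᴸ≈1 : σ * εᴸ ≈ 1#) (balance : d * (1# - εᴸ - εᵁ) ≈ 1#) (upper : Barrier cᵁ εᵁ) (lower : Barrier cᴸ εᴸ) (e₁ : Fin K) (y₁ : Vector Carrier N) (0<w₁ : 0# < w e₁) (0<f₁² : 0# < f e₁ y₁ * f e₁ y₁) where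

      module U = Barrier upper
      module L = Barrier lower

      cᵁ′ cᴸ′ : Vector Carrier K
      cᵁ′ = cᵁ +[ d ] w
      cᴸ′ = cᴸ +[ - 1# ] w

      solᵁ : ∃ λ q → Solves cᵁ′ q
      solᵁ = solvable cᵁ′ d 0<d λ x → ≤-resp (+-identityˡ _) (sym (form-linear-coeff cᵁ d w x x)) (+-monoˡ-≤ (d * M x x) (U.psd x))

      -- `M≤potential` and the bound give M ≤ εᴸ times the form of `cᴸ`. As 1/εᴸ = σ > 1, a multiple
      -- σ - 1 of M is left over when the lower barrier advances by 1, which keeps the new lower
      -- form definite.
      σM≤ : ∀ x → σ * M x x ≤ form cᴸ x x
      σM≤ x = begin
        σ * M x x                                ≤⟨ *-monoˡ-≤ (<⇒≤ (<-trans 0<1 1<σ)) (M≤potential cᴸ L.sol L.psd L.solves x) ⟩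
        σ * (potential L.sol * form cᴸ x x)      ≈⟨ solve 3 (λ s p f → s :* (p :* f) := s :* f :* p) refl σ (potential L.sol) (form cᴸ x x) ⟩
        σ * form cᴸ x x * potential L.sol        ≤⟨ *-monoˡ-≤ (*-nonneg (<⇒≤ (<-trans 0<1 1<σ)) (L.psd x)) L.bound ⟩
        σ * form cᴸ x x * εᴸ                     ≈⟨ solve 3 (λ s f e → s :* f :* e := s :* e :* f) refl σ (form cᴸ x x) εᴸ ⟩
        σ * εᴸ * form cᴸ x x                     ≈⟨ trans (*-congʳ σεᴸ≈1) (*-identityˡ _) ⟩
        form cᴸ x x                              ∎
        where open ≤-Reasoning

      [σ-1]M≤ : ∀ x → (σ - 1#) * M x x ≤ form cᴸ′ x x
      [σ-1]M≤ x = ≤-resp (solve 2 (λ s m → s :* m :+ :- :1 :* m := (s :- :1) :* m) refl σ (M x x))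
        (sym (form-linear-coeff cᴸ (- 1#) w x x)) (+-monoˡ-≤ (- 1# * M x x) (σM≤ x))

      solᴸ : ∃ λ p → Solves cᴸ′ p
      solᴸ = solvable cᴸ′ (σ - 1#) (x<y⇒0<y-x 1<σ) [σ-1]M≤

      psdᴸ′ : PSD cᴸ′
      psdᴸ′ x = ≤-trans (*-nonneg (<⇒≤ (x<y⇒0<y-x 1<σ)) (M-psd x)) ([σ-1]M≤ x)

      form-shiftᴸ : ∀ x y → form cᴸ x y ≈ form cᴸ′ x y + 1# * M x y
      form-shiftᴸ x y = trans (solve 2 (λ F m → F := (F :+ :- :1 :* m) :+ :1 :* m) refl (form cᴸ x y) (M x y))
        (+-congʳ (sym (form-linear-coeff cᴸ (- 1#) w x y)))

      pᵁ qᵁ pᴸ qᴸ : Fin K → V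
      pᵁ = U.sol
      qᵁ = proj₁ solᵁ
      pᴸ = proj₁ solᴸ
      qᴸ = L.sol

      module SU = Shift cᵁ cᵁ′ d 0<d (form-linear-coeff cᵁ d w) U.psd pᵁ qᵁ U.solves (proj₂ solᵁ)
      module SL = Shift cᴸ′ cᴸ 1# 0<1 form-shiftᴸ psdᴸ′ pᴸ qᴸ (proj₂ solᴸ) L.solves

      -- The changes of the potentials under the shifts: the upper one falls by `D`, the lower one
      -- rises by `s`.
      Sᵁ s D : Carrier
      Sᵁ = M-pairing pᵁ qᵁ
      s = M-pairing pᴸ qᴸ
      D = d * Sᵁ

      0<s : 0# < s
      0<s = SL.M-pairing-pos e₁ y₁ 0<w₁ 0<f₁²

      0<Sᵁ : 0# < Sᵁ
      0<Sᵁ = SU.M-pairing-pos e₁ y₁ 0<w₁ 0<f₁²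

      0<D : 0# < D
      0<D = *-pos 0<d 0<Sᵁ

      Aᴸ Fᴸ Aᵁ Fᵁ gain : Vector Carrier K
      Aᴸ e = M (pᴸ e) (pᴸ e)
      Fᴸ e = f e (pᴸ e)
      Aᵁ e = M (qᵁ e) (qᵁ e)
      Fᵁ e = f e (qᵁ e)
      -- Some t satisfies U_A(e) < 1 / t = L_A(e), in the notation of the two-barrier
      -- argument, as soon as gain e is positive: it is L_A(e) - U_A(e) with the
      -- denominators s and D cleared.
      gain = ((((λ _ → 0#) +[ D ] Aᴸ) +[ - (D * s) ] Fᴸ) +[ - s ] Aᵁ) +[ - (s * D) ] Fᵁ

      total-gain : sum (λ e → w e * gain e) ≈
        D * (M-pairing pᴸ pᴸ - s * potential pᴸ) - s * (M-pairing qᵁ qᵁ + D * potential qᵁ)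
      total-gain = begin
        sum (λ e → w e * gain e)
          ≈⟨ weighted-linear g₃ (- (s * D)) Fᵁ ⟩
        sum (λ e → w e * g₃ e) + - (s * D) * potential qᵁ
          ≈⟨ +-congʳ (weighted-linear g₂ (- s) Aᵁ) ⟩
        sum (λ e → w e * g₂ e) + - s * M-pairing qᵁ qᵁ + - (s * D) * potential qᵁ
          ≈⟨ +-congʳ (+-congʳ (weighted-linear g₁ (- (D * s)) Fᴸ)) ⟩
        sum (λ e → w e * g₁ e) + - (D * s) * potential pᴸ + - s * M-pairing qᵁ qᵁ + - (s * D) * potential qᵁ
          ≈⟨ +-congʳ (+-congʳ (+-congʳ (trans (weighted-linear (λ _ → 0#) D Aᴸ) (+-congʳ weighted-zero)))) ⟩
        0# + D * M-pairing pᴸ pᴸ + - (D * s) * potential pᴸ + - s * M-pairing qᵁ qᵁ + - (s * D) * potential qᵁ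
          ≈⟨ solve 6 (λ D s T P T′ P′ → :0 :+ D :* T :+ :- (D :* s) :* P :+ :- s :* T′ :+ :- (s :* D) :* P′
               := D :* (T :- s :* P) :- s :* (T′ :+ D :* P′)) refl D s (M-pairing pᴸ pᴸ) (potential pᴸ) (M-pairing qᵁ qᵁ) (potential qᵁ) ⟩
        D * (M-pairing pᴸ pᴸ - s * potential pᴸ) - s * (M-pairing qᵁ qᵁ + D * potential qᵁ) ∎
        where
        open import Relation.Binary.Reasoning.Setoid setoid
        g₁ g₂ g₃ : Vector Carrier K
        g₁ = (λ _ → 0#) +[ D ] Aᴸ
        g₂ = g₁ +[ - (D * s) ] Fᴸ
        g₃ = g₂ +[ - s ] Aᵁ
        weighted-zero : sum (λ e → w e * 0#) ≈ 0#
        weighted-zero = trans (sum-cong-≋ (λ e → zeroʳ (w e))) (sum-replicate-zero K)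

      -- The total gain exceeds s D² by a sum of nonnegative terms.
      0<total-gain : 0# < sum (λ e → w e * gain e)
      0<total-gain = <-respʳ-≈ (sym (trans total-gain eq))
        (+-pos-nonneg (*-pos 0<s (*-pos 0<D 0<D))
          (+-nonneg (+-nonneg (+-nonneg
            (*-nonneg (<⇒≤ 0<D) (x≤y⇒0≤y-x (SL.M-pairing-pp s)))
            (*-nonneg (<⇒≤ 0<s) (x≤y⇒0≤y-x SU.M-pairing-qq≤pq)))
            (*-nonneg (*-nonneg (<⇒≤ 0<s) (<⇒≤ 0<D)) (*-nonneg (<⇒≤ 0<s) (+-nonneg (<⇒≤ (x<y⇒0<y-x εᴸ<1)) (x≤y⇒0≤y-x L.bound)))))
            (*-nonneg (*-nonneg (<⇒≤ 0<s) (<⇒≤ 0<D)) (+-nonneg (x≤y⇒0≤y-x L.bound) (x≤y⇒0≤y-x U.bound)))))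
        where
        open import Relation.Binary.Reasoning.Setoid setoid
        Tᴸ Tᵁ Φpᴸ Φqᴸ Φpᵁ Φqᵁ : Carrier
        Tᴸ = M-pairing pᴸ pᴸ
        Tᵁ = M-pairing qᵁ qᵁ
        Φpᴸ = potential pᴸ
        Φqᴸ = potential qᴸ
        Φpᵁ = potential pᵁ
        Φqᵁ = potential qᵁ
        -- The slack in `SL.M-pairing-pp` at τ = s, in `SU.M-pairing-qq≤pq`, in εᴸ < 1 and in the
        -- bounds on the potentials. The optimal 1 + τ is the quotient of the two lower potentials,
        -- but 1 + s suffices and needs no division. The surplus s D² remains because the upper
        -- average involves the potential after the shift, which is smaller by `D`.
        excess : Carrier → Carrier → Carrier
        excess Φpᴸ Φpᵁ =
          D * ((1# * Tᴸ + (1# + s) * (1# + s) * Φqᴸ) - (1# + s + s) * Φpᴸ)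
          + s * (Sᵁ - Tᵁ)
          + s * D * (s * ((1# - εᴸ) + (εᴸ - Φqᴸ)))
          + s * D * ((εᴸ - Φqᴸ) + (εᵁ - Φpᵁ))
        excess-cong : ∀ {x x′ y y′} → x ≈ x′ → y ≈ y′ → excess x y ≈ excess x′ y′
        excess-cong x≈x′ y≈y′ = +-cong (+-congʳ (+-congʳ (*-congˡ (+-congˡ (-‿cong (*-congˡ x≈x′))))))
          (*-congˡ (+-congˡ (+-congˡ (-‿cong y≈y′))))
        eq : D * (Tᴸ - s * Φpᴸ) - s * (Tᵁ + D * Φqᵁ) ≈ s * (D * D) + excess Φpᴸ Φpᵁ
        eq = begin
          D * (Tᴸ - s * Φpᴸ) - s * (Tᵁ + D * Φqᵁ)
            ≈⟨ +-congʳ (*-congˡ (+-congˡ (-‿cong (*-congˡ SL.potential-difference)))) ⟩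
          D * (Tᴸ - s * (Φqᴸ + 1# * s)) - s * (Tᵁ + D * Φqᵁ)
            ≈⟨ solve 9 (λ d S s T Q T′ Q′ E U →
                 d :* S :* (T :- s :* (Q :+ :1 :* s)) :- s :* (T′ :+ d :* S :* Q′)
                 := (s :* (d :* S :* (d :* S)) :+
                   (d :* S :* ((:1 :* T :+ (:1 :+ s) :* (:1 :+ s) :* Q) :- (:1 :+ s :+ s) :* (Q :+ :1 :* s))
                   :+ s :* (S :- T′)
                   :+ s :* (d :* S) :* (s :* ((:1 :- E) :+ (E :- Q)))
                   :+ s :* (d :* S) :* ((E :- Q) :+ (U :- (Q′ :+ d :* S)))))
                   :+ s :* S :* (d :* (:1 :- E :- U) :- :1))
                 refl d Sᵁ s Tᴸ Φqᴸ Tᵁ Φqᵁ εᴸ εᵁ ⟩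
          (s * (D * D) + excess (Φqᴸ + 1# * s) (Φqᵁ + D)) + s * Sᵁ * (d * (1# - εᴸ - εᵁ) - 1#)
            ≈⟨ +-cong (+-congˡ (excess-cong (sym SL.potential-difference) (sym SU.potential-difference)))
                 (trans (*-congˡ (trans (+-congʳ balance) (-‿inverseʳ 1#))) (zeroʳ _)) ⟩
          (s * (D * D) + excess Φpᴸ Φpᵁ) + 0#
            ≈⟨ +-identityʳ _ ⟩
          s * (D * D) + excess Φpᴸ Φpᵁ ∎

      module Update (e : Fin K) (0<gain : 0# < gain e) where
        m φ m′ φ′ g : Carrier
        m = Aᵁ e
        φ = Fᵁ e
        m′ = Aᴸ e
        φ′ = Fᴸ e
        g = m′ - s * φ′

        0≤φ : 0# ≤ φ
        0≤φ = SU.f-q-nonneg e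

        0≤φ′ : 0# ≤ φ′
        0≤φ′ = ≤-resp refl (proj₂ solᴸ e (pᴸ e)) (psdᴸ′ (pᴸ e))

        s[m+Dφ]<Dg : s * (m + D * φ) < D * g
        s[m+Dφ]<Dg = 0<y-x⇒x<y (<-respʳ-≈
          (solve 6 (λ D s m φ m′ φ′ → :0 :+ D :* m′ :+ :- (D :* s) :* φ′ :+ :- s :* m :+ :- (s :* D) :* φ
             := D :* (m′ :- s :* φ′) :- s :* (m :+ D :* φ)) refl D s m φ m′ φ′)
          0<gain)

        0≤m+Dφ : 0# ≤ m + D * φ
        0≤m+Dφ = +-nonneg (M-psd (qᵁ e)) (*-nonneg (<⇒≤ 0<D) 0≤φ)

        0<g : 0# < g
        0<g = 0<x∧0<xy⇒0<y 0<D (≤-<-trans (*-nonneg (<⇒≤ 0<s) 0≤m+Dφ) s[m+Dφ]<Dg)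

        -- 1/t = g/s is the lower quantity L_A(e), so t is the smallest multiple of the edge that
        -- restores the lower potential. That potential returns exactly to its old value, and all
        -- the slack lies on the upper side.
        t : Carrier
        t = s * proj₁ (reciprocal 0<g)

        0<t : 0# < t
        0<t = *-pos 0<s (proj₁ (proj₂ (reciprocal 0<g)))

        gt≈s : g * t ≈ s
        gt≈s = trans (solve 3 (λ g s v → g :* (s :* v) := s :* (g :* v)) refl g s (proj₁ (reciprocal 0<g)))
          (trans (*-congˡ (proj₂ (proj₂ (reciprocal 0<g)))) (*-identityʳ s))

        t[m+Dφ]<D : t * (m + D * φ) < D
        t[m+Dφ]<D = *-cancelˡ-< 0<g (<-respˡ-≈ (trans (*-congʳ (sym gt≈s)) (*-assoc g t _)) (<-respʳ-≈ (*-comm D g) s[m+Dφ]<Dg))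

        ω : Carrier
        ω = 1# + - t * φ

        0<ω : 0# < ω
        0<ω = 0<x∧0<xy⇒0<y 0<D (<-respʳ-≈
          (solve 4 (λ D t m φ → (D :- t :* (m :+ D :* φ)) :+ t :* m := D :* (:1 :+ :- t :* φ)) refl D t m φ)
          (+-pos-nonneg (x<y⇒0<y-x t[m+Dφ]<D) (*-nonneg (<⇒≤ 0<t) (M-psd (qᵁ e)))))

        upper′ : Barrier (cᵁ′ +[ - t ] δ e) εᵁ
        upper′ = record
          { psd    = λ x → ≤-trans (*-nonneg (<⇒≤ 0<ω) (SU.psd′ x)) (ω*form≤ x)
          ; sol    = R.updated
          ; solves = R.updated-solves
          ; bound  = ≤-trans (≤-reflexive R.updated-potential) (≤-trans (+-monoʳ-≤ (potential qᵁ) βm≤D)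
                       (≤-trans (≤-reflexive (sym SU.potential-difference)) U.bound))
          }
          where
          β : Carrier
          β = proj₁ (reciprocal 0<ω) * t

          ωβ≈t : ω * β ≈ t
          ωβ≈t = trans (sym (*-assoc _ _ _)) (trans (*-congʳ (proj₂ (proj₂ (reciprocal 0<ω)))) (*-identityˡ t))

          module R = ShermanMorrison cᵁ′ qᵁ (proj₂ solᵁ) e (- t) β
            (trans (*-comm β ω) (trans ωβ≈t (solve 1 (λ t → t := :- (:- t)) refl t)))

          -- Multiplied by `ω` this follows from `t[m+Dφ]<D`: the update adds no more to the upper
          -- potential than the shift took away.
          βm≤D : β * m ≤ D
          βm≤D = *-cancelˡ-≤ 0<ω (0≤y-x⇒x≤y (≤-resp refl
            (trans (solve 4 (λ D t m φ → D :- t :* (m :+ D :* φ) := (:1 :+ :- t :* φ) :* D :- t :* m) refl D t m φ)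
              (+-congˡ (-‿cong (trans (*-congʳ (sym ωβ≈t)) (*-assoc ω β m)))))
            (<⇒≤ (x<y⇒0<y-x t[m+Dφ]<D))))

          -- By `f²≤`, removing t (f e)² costs at most the fraction t φ of the form, and `ω` is 1 -
          -- t φ.
          ω*form≤ : ∀ x → ω * form cᵁ′ x x ≤ form (cᵁ′ +[ - t ] δ e) x x
          ω*form≤ x = ≤-resp
            (solve 3 (λ F t φ → F :+ :- (t :* (φ :* F)) := (:1 :+ :- t :* φ) :* F) refl F t φ)
            (sym (trans (form-linear-coeff cᵁ′ (- t) (δ e) x x) (+-congˡ (trans (*-congˡ (form-δ e x x)) (solve 2 (λ t q → :- t :* q := :- (t :* q)) refl t (f e x * f e x))))))
            (0≤y-x⇒x≤y (≤-resp refl (solve 3 (λ F a b → b :- a := (F :+ :- a) :- (F :+ :- b)) refl F (t * (f e x * f e x)) (t * (φ * F)))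
              (x≤y⇒0≤y-x (*-monoˡ-≤ (<⇒≤ 0<t) (f²≤ cᵁ′ qᵁ SU.psd′ (proj₂ solᵁ) e x)))))
            where
            F : Carrier
            F = form cᵁ′ x x

        ω′ : Carrier
        ω′ = 1# + t * φ′

        0<ω′ : 0# < ω′
        0<ω′ = +-pos-nonneg 0<1 (*-nonneg (<⇒≤ 0<t) 0≤φ′)

        lower′ : Barrier (cᴸ′ +[ t ] δ e) εᴸ
        lower′ = record
          { psd    = λ x → ≤-resp refl (sym (trans (form-linear-coeff cᴸ′ t (δ e) x x) (+-congˡ (*-congˡ (form-δ e x x)))))
                       (+-nonneg (psdᴸ′ x) (*-nonneg (<⇒≤ 0<t) (0≤x² (f e x))))
          ; sol    = R.updated
          ; solves = R.updated-solves
          ; bound  = ≤-trans (≤-reflexive (trans R.updated-potential (trans (+-cong SL.potential-difference βm′≈-s)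
                       (solve 2 (λ Q s → Q :+ :1 :* s :+ :- s := Q) refl (potential qᴸ) s)))) L.bound
          }
          where
          β : Carrier
          β = proj₁ (reciprocal 0<ω′) * - t

          ω′β≈-t : ω′ * β ≈ - t
          ω′β≈-t = trans (sym (*-assoc _ _ _)) (trans (*-congʳ (proj₂ (proj₂ (reciprocal 0<ω′)))) (*-identityˡ (- t)))

          module R = ShermanMorrison cᴸ′ pᴸ (proj₂ solᴸ) e t β (trans (*-comm β ω′) ω′β≈-t)

          βm′≈-s : β * m′ ≈ - s
          βm′≈-s = *-cancelˡ-≈ (#-sym (<⇒# 0<ω′)) (begin
            ω′ * (β * m′)                         ≈⟨ *-assoc ω′ β m′ ⟨
            ω′ * β * m′                           ≈⟨ *-congʳ ω′β≈-t ⟩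
            - t * m′                              ≈⟨ solve 4 (λ t m s φ → :- t :* m := :- ((m :- s :* φ) :* t) :+ t :* φ :* :- s) refl t m′ s φ′ ⟩
            - (g * t) + t * φ′ * - s              ≈⟨ +-congʳ (-‿cong gt≈s) ⟩
            - s + t * φ′ * - s                    ≈⟨ solve 3 (λ s t φ → :- s :+ t :* φ :* :- s := (:1 :+ t :* φ) :* :- s) refl s t φ′ ⟩
            ω′ * - s                              ∎)
            where open import Relation.Binary.Reasoning.Setoid setoid

      step : ∃₂ λ e t → 0# < w e × 0# < t × Barrier (cᵁ′ +[ - t ] δ e) εᵁ × Barrier (cᴸ′ +[ t ] δ e) εᴸ
      step = e , t , 0<wₑ , 0<t , upper′ , lower′
        where
        choice : ∃ λ e → 0# < w e * gain e
        choice = sum-pos⇒∃ (λ e → w e * gain e) 0<total-gain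
        e : Fin K
        e = proj₁ choice
        0<wₑ : 0# < w e
        0<wₑ = 0<xy∧0≤x⇒0<x (proj₂ choice) (0≤w e)
        open Update e (0<x∧0<xy⇒0<y 0<wₑ (proj₂ choice))

-- Repeated selection of edges.

module Sparsifiers {c₀ ℓ₁ ℓ₂} (ℝ : RealNumbers c₀ ℓ₁ ℓ₂) where
  open GraphsOver ℝ
  open OrderedField ℝ
  open WeightedForms ℝ
  open Barriers ℝ
  open Steps ℝ
  private module ∑ℕ = SemiringSum ℕ.+-*-semiring

  count : ∀ {K} → (Fin K → Bool) → ℕ
  count S = ∑ℕ.sum λ e → if S e then 1 else 0

  insert : ∀ {K} → Fin K → (Fin K → Bool) → Fin K → Bool
  insert e S e′ = does (e ≟ e′) ∨ S e′

  -- An inequality, since the same edge may be selected in several steps.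
  count-insert : ∀ {K} (e : Fin K) (S : Fin K → Bool) → count (insert e S) ℕ.≤ suc (count S)
  count-insert fzero    S = ℕ.s≤s (ℕ.m≤n+m _ (if S fzero then 1 else 0))
  count-insert (fsuc e) S = ℕ.≤-trans
    (ℕ.+-monoʳ-≤ (if S fzero then 1 else 0) (count-insert e (S ∘ fsuc)))
    (ℕ.≤-reflexive (ℕ.+-suc _ _))

  count-false : ∀ {K} → count {K} (λ _ → false) ≡ 0
  count-false {K} = ∑ℕ.sum-replicate-zero K

  -- Vanishing of a real coefficient cannot be decided, so the set of chosen edges is a Boolean
  -- `support` beside the coefficients. Membership also records `0 < w e`, from which it is later
  -- read off that the index is an edge of the graph.
  record Selection {K : ℕ} (w : Vector Carrier K) : Set (c₀ ⊔ ℓ₁ ⊔ ℓ₂) where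
    field
      coeff   : Vector Carrier K
      support : Fin K → Bool
      pos     : ∀ e → support e ≡ true → 0# < coeff e × 0# < w e
      zeros   : ∀ e → support e ≡ false → coeff e ≈ 0#

    nonneg : ∀ e → 0# ≤ coeff e
    nonneg e with support e in eq
    ... | true  = <⇒≤ (proj₁ (pos e eq))
    ... | false = ≤-reflexive (sym (zeros e eq))

  module _ {K : ℕ} {w : Vector Carrier K} where
    open Selection

    empty : Selection w
    empty = record { coeff = λ _ → 0# ; support = λ _ → false ; pos = λ _ () ; zeros = λ _ _ → refl }

    add : (e : Fin K) (t : Carrier) → 0# < w e → 0# < t → Selection w → Selection w
    add e t 0<w 0<t σ = record
      { coeff   = coeff σ +[ t ] δ e
      ; support = insert e (support σ)
      ; pos     = pos′
      ; zeros   = zeros′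
      }
      where
      off : ∀ x → x + t * 0# ≈ x
      off x = trans (+-congˡ (zeroʳ t)) (+-identityʳ x)
      on : ∀ {x} → 0# ≤ x → 0# < x + t * 1#
      on 0≤x = +-nonneg-pos 0≤x (<-respʳ-≈ (sym (*-identityʳ t)) 0<t)
      pos′ : ∀ e′ → insert e (support σ) e′ ≡ true → 0# < (coeff σ +[ t ] δ e) e′ × 0# < w e′
      pos′ e′ eq with e ≟ e′
      ... | yes ≡.refl = on (nonneg σ e′) , 0<w
      ... | no  _      = <-respʳ-≈ (sym (off (coeff σ e′))) (proj₁ (pos σ e′ eq)) , proj₂ (pos σ e′ eq)
      zeros′ : ∀ e′ → insert e (support σ) e′ ≡ false → (coeff σ +[ t ] δ e) e′ ≈ 0#
      zeros′ e′ eq with e ≟ e′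
      ... | no _ = trans (off (coeff σ e′)) (zeros σ e′ eq)

    scale : ∀ a → 0# < a → Selection w → Selection w
    scale a 0<a σ = record
      { coeff   = λ e → a * coeff σ e
      ; support = support σ
      ; pos     = λ e eq → *-pos 0<a (proj₁ (pos σ e eq)) , proj₂ (pos σ e eq)
      ; zeros   = λ e eq → trans (*-congˡ (zeros σ e eq)) (zeroʳ a)
      }

  module Iteration {N K : ℕ} (b : Fin K → Vector Carrier (suc N)) (w : Vector Carrier K) (0≤w : ∀ e → 0# ≤ w e) (w-def : Forms.Definite b w) where
    open Definite b w 0≤w w-def public
    open Selection

    n̂ : Carrier
    n̂ = fromℕ (suc N)

    Barrier-cong : ∀ {c c′ ε} → (∀ e → c e ≈ c′ e) → Barrier c ε → Barrier c′ ε
    Barrier-cong c≈c′ B = record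
      { psd    = λ x → ≤-resp refl (form-cong c≈c′ x x) (psd x)
      ; sol    = sol
      ; solves = λ e y → trans (sym (form-cong c≈c′ (sol e) y)) (solves e y)
      ; bound  = bound
      }
      where open Barrier B

    form-scale : ∀ a c x y → form (λ e → a * c e) x y ≈ a * form c x y
    form-scale a c x y = trans (sum-cong-≋ λ e → *-assoc a (c e) (f e x * f e y))
      (sym (*-distribˡ-sum a (λ e → c e * (f e x * f e y))))

    -- Tr (M⁻¹M) is the dimension.
    initial : ∀ a ε → 0# < a → n̂ ≤ a * ε → Barrier (λ e → a * w e) ε
    initial a ε 0<a n≤aε = record
      { psd    = λ x → ≤-resp refl (sym (form-scale a w x x)) (*-nonneg (<⇒≤ 0<a) (M-psd x))
      ; sol    = q
      ; solves = q-solves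
      ; bound  = *-cancelˡ-≤ 0<a (≤-trans (≤-reflexive a*potential) n≤aε)
      }
      where
      open import Relation.Binary.Reasoning.Setoid setoid
      solution : ∃ λ q → Solves (λ e → a * w e) q
      solution = solvable (λ e → a * w e) a 0<a (λ x → ≤-reflexive (sym (form-scale a w x x)))
      q : Fin K → V
      q = proj₁ solution
      q-solves : Solves (λ e → a * w e) q
      q-solves = proj₂ solution

      -- `z i` is column i of M⁻¹. Pairing it with `q e` expresses a times coordinate i of `q e` as
      -- f e (z i); after exchanging the sums, a times the potential is a sum of M (z i) (δ i) = 1
      -- over the coordinates.
      dual : ∀ i → ∃ λ z → ∀ y → M z y ≈ sum λ j → y j * δ i j
      dual i = representable w w-def (δ i)
      z : Fin (suc N) → V
      z i = proj₁ (dual i)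
      M-z : ∀ i y → M (z i) y ≈ y i
      M-z i y = trans (proj₂ (dual i) y) (trans (sum-cong-≋ λ j → *-comm (y j) (δ i j)) (sum-δ i y))

      aq : ∀ e i → a * q e i ≈ f e (z i)
      aq e i = begin
        a * q e i                          ≈⟨ *-congˡ (M-z i (q e)) ⟨
        a * M (z i) (q e)                  ≈⟨ *-congˡ (form-sym w (z i) (q e)) ⟩
        a * M (q e) (z i)                  ≈⟨ form-scale a w (q e) (z i) ⟨
        form (λ e → a * w e) (q e) (z i)   ≈⟨ q-solves e (z i) ⟩
        f e (z i)                          ∎

      f-δ : ∀ e i → f e (δ i) ≈ b e i
      f-δ e i = trans (sum-cong-≋ λ j → *-comm (b e j) (δ i j)) (sum-δ i (b e))

      δᵢᵢ : ∀ {n} (i : Fin n) → δ i i ≈ 1#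
      δᵢᵢ fzero    = refl
      δᵢᵢ (fsuc i) = δᵢᵢ i

      term : ∀ e → a * (w e * f e (q e)) ≈ sum λ i → w e * (f e (z i) * f e (δ i))
      term e = begin
        a * (w e * f e (q e))
          ≈⟨ solve 3 (λ a w f → a :* (w :* f) := w :* a :* f) refl a (w e) (f e (q e)) ⟩
        w e * a * sum (λ i → b e i * q e i)
          ≈⟨ *-distribˡ-sum (w e * a) (λ i → b e i * q e i) ⟩
        sum (λ i → w e * a * (b e i * q e i))
          ≈⟨ sum-cong-≋ (λ i → trans (solve 4 (λ w a b q → w :* a :* (b :* q) := w :* (a :* q :* b)) refl (w e) a (b e i) (q e i))
               (*-congˡ (*-cong (aq e i) (sym (f-δ e i))))) ⟩
        sum (λ i → w e * (f e (z i) * f e (δ i))) ∎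

      a*potential : a * potential q ≈ n̂
      a*potential = begin
        a * potential q                                          ≈⟨ *-distribˡ-sum a (λ e → w e * f e (q e)) ⟩
        sum (λ e → a * (w e * f e (q e)))                        ≈⟨ sum-cong-≋ term ⟩
        sum (λ e → sum λ i → w e * (f e (z i) * f e (δ i)))      ≈⟨ ∑-comm (λ e i → w e * (f e (z i) * f e (δ i))) ⟩
        sum (λ i → M (z i) (δ i))                                ≈⟨ sum-cong-≋ (λ i → trans (M-z i (δ i)) (δᵢᵢ i)) ⟩
        sum {suc N} (λ i → 1#)                                   ≈⟨ sum-replicate (suc N) ⟩
        n̂                                                        ∎

    -- The certificate that `Step` asks for. It depends on M alone, so one serves all steps; it
    -- exists because there is at least one coordinate, whence the dimension `suc N`.
    heavy : ∃₂ λ e y → 0# < w e × 0# < f e y * f e y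
    heavy = e , y , 0<w , 0<x∧0<xy⇒0<y 0<w (proj₂ positive)
      where
      y : V
      y = δ fzero
      positive : ∃ λ e → 0# < w e * (f e y * f e y)
      positive = sum-pos⇒∃ (λ e → w e * (f e y * f e y)) (w-def y (fzero , #-sym (<⇒# 0<1)))
      e : Fin K
      e = proj₁ positive
      0<w : 0# < w e
      0<w = 0<xy∧0≤x⇒0<x (proj₂ positive) (0≤w e)

    module _ (u₀ l₀ εᵁ εᴸ d σ : Carrier) (0<d : 0# < d) (εᴸ<1 : εᴸ < 1#) (1<σ : 1# < σ) (σεᴸ≈1 : σ * εᴸ ≈ 1#) (balance : d * (1# - εᴸ - εᵁ) ≈ 1#) where

      Between : ℕ → Vector Carrier K → Set (c₀ ⊔ ℓ₁ ⊔ ℓ₂)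
      Between k t =
        Barrier (λ e → (u₀ + fromℕ k * d) * w e - t e) εᵁ ×
        Barrier (λ e → t e - (l₀ + fromℕ k) * w e) εᴸ

      iterate : Between 0 (λ _ → 0#) → ∀ k →
        ∃ λ (τ : Selection w) → count (support τ) ℕ.≤ k × Between k (coeff τ)
      iterate start zero    = empty , ℕ.≤-reflexive (count-false {K}) , start
      iterate start (suc k) = advance (iterate start k)
        where
        advance : (∃ λ (τ : Selection w) → count (support τ) ℕ.≤ k × Between k (coeff τ)) →
          ∃ λ (τ : Selection w) → count (support τ) ℕ.≤ suc k × Between (suc k) (coeff τ)
        advance (τ , count≤k , upper , lower) =
          add e t 0<w 0<t τ , ℕ.≤-trans (count-insert e (support τ)) (ℕ.s≤s count≤k) ,
          Barrier-cong (λ e′ → solve 7 (λ u k d w c t δ → ((u :+ k :* d) :* w :- c :+ d :* w) :+ :- t :* δ := (u :+ (:1 :+ k) :* d) :* w :- (c :+ t :* δ))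
            refl u₀ (fromℕ k) d (w e′) (coeff τ e′) t (δ e e′)) (proj₁ (proj₂ (proj₂ (proj₂ (proj₂ next))))) ,
          Barrier-cong (λ e′ → solve 6 (λ l k w c t δ → (c :- (l :+ k) :* w :+ :- :1 :* w) :+ t :* δ := (c :+ t :* δ) :- (l :+ (:1 :+ k)) :* w)
            refl l₀ (fromℕ k) (w e′) (coeff τ e′) t (δ e e′)) (proj₂ (proj₂ (proj₂ (proj₂ (proj₂ next)))))
          where
          module S = Step (λ e → (u₀ + fromℕ k * d) * w e - coeff τ e) (λ e → coeff τ e - (l₀ + fromℕ k) * w e)
            εᵁ εᴸ d σ 0<d εᴸ<1 1<σ σεᴸ≈1 balance upper lower
            (proj₁ heavy) (proj₁ (proj₂ heavy)) (proj₁ (proj₂ (proj₂ heavy))) (proj₂ (proj₂ (proj₂ heavy)))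
          next = S.step
          e : Fin K
          e = proj₁ next
          t : Carrier
          t = proj₁ (proj₂ next)
          0<w : 0# < w e
          0<w = proj₁ (proj₂ (proj₂ next))
          0<t : 0# < t
          0<t = proj₁ (proj₂ (proj₂ (proj₂ next)))

-- The constants and the resulting approximation.

module TwiceRamanujan {c₀ ℓ₁ ℓ₂} (ℝ : RealNumbers c₀ ℓ₁ ℓ₂) where
  open GraphsOver ℝ
  open OrderedField ℝ
  open WeightedForms ℝ
  open Sparsifiers ℝ

  module _ {N K : ℕ} (b : Fin K → Vector Carrier (suc N)) (w : Vector Carrier K) (0≤w : ∀ e → 0# ≤ w e) (w-def : Forms.Definite b w) where
    open Iteration b w 0≤w w-def
    open Selection

    -- After m steps l M ≤ A ≤ u M; dividing by l gives M ≤ A/l ≤ (u/l) M, and `u≤κl` bounds the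
    -- quotient.
    sparsify : ∀ s κ → 1# < s → (s - 1#) * (s - 1#) * κ ≈ (s + 1#) * (s + 1#) →
      ∀ m → fromℕ (suc N) * (s * s) ≤ fromℕ m →
      ∃ λ (τ : Selection w) → count (support τ) ℕ.≤ m ×
        (∀ x → M x x ≤ form (coeff τ) x x × form (coeff τ) x x ≤ κ * M x x)
    sparsify s κ 1<s κ-eq m ns²≤m = scale λ′ 0<λ τ , proj₁ (proj₂ final) , λ x →
        ≤-resp (trans (sym (*-assoc λ′ l (M x x))) (trans (*-congʳ λl≈1) (*-identityˡ _))) (sym (form-scale λ′ t x x))
          (*-monoˡ-≤ (<⇒≤ 0<λ) (lM≤ x))
      , ≤-resp (sym (form-scale λ′ t x x)) (λκl x)
          (*-monoˡ-≤ (<⇒≤ 0<λ) (≤-trans (≤uM x) (≤-resp (*-comm _ _) (*-comm _ _) (*-monoˡ-≤ (M-psd x) u≤κl))))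
      where
      open import Relation.Binary.Reasoning.Setoid setoid
      0<s : 0# < s
      0<s = <-trans 0<1 1<s
      0<s-1 : 0# < s - 1#
      0<s-1 = x<y⇒0<y-x 1<s
      0<s+1 : 0# < s + 1#
      0<s+1 = +-pos-nonneg 0<s (<⇒≤ 0<1)

      i r v d εᵁ : Carrier
      i = proj₁ (reciprocal 0<s-1)
      r = proj₁ (reciprocal 0<s+1)
      v = proj₁ (reciprocal 0<s)
      d = (s + 1#) * i
      -- The solution of `balance`: (s - 1) r = (s - 1)/(s + 1) is the inverse of the upper step
      -- `d`. Its closed form is 1/(s d), by `sdεᵁ≈1`.
      εᵁ = 1# - v - (s - 1#) * r

      [s-1]i≈1 : (s - 1#) * i ≈ 1#
      [s-1]i≈1 = proj₂ (proj₂ (reciprocal 0<s-1))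
      [s+1]r≈1 : (s + 1#) * r ≈ 1#
      [s+1]r≈1 = proj₂ (proj₂ (reciprocal 0<s+1))
      sv≈1 : s * v ≈ 1#
      sv≈1 = proj₂ (proj₂ (reciprocal 0<s))

      0<d : 0# < d
      0<d = *-pos 0<s+1 (proj₁ (proj₂ (reciprocal 0<s-1)))
      v<1 : v < 1#
      v<1 = *-cancelˡ-< 0<s (<-respˡ-≈ (sym sv≈1) (<-respʳ-≈ (sym (*-identityʳ s)) 1<s))

      d[s-1]r≈1 : d * ((s - 1#) * r) ≈ 1#
      d[s-1]r≈1 = begin
        (s + 1#) * i * ((s - 1#) * r)      ≈⟨ solve 3 (λ s i r → (s :+ :1) :* i :* ((s :- :1) :* r) := ((s :- :1) :* i) :* ((s :+ :1) :* r)) refl s i r ⟩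
        (s - 1#) * i * ((s + 1#) * r)      ≈⟨ *-cong [s-1]i≈1 [s+1]r≈1 ⟩
        1# * 1#                            ≈⟨ *-identityˡ 1# ⟩
        1#                                 ∎

      balance : d * (1# - v - εᵁ) ≈ 1#
      balance = trans (solve 3 (λ d v p → d :* (:1 :- v :- (:1 :- v :- p)) := d :* p) refl d v ((s - 1#) * r)) d[s-1]r≈1

      sdεᵁ≈1 : s * d * εᵁ ≈ 1#
      sdεᵁ≈1 = begin
        s * d * (1# - v - (s - 1#) * r)
          ≈⟨ solve 4 (λ s d v p → s :* d :* (:1 :- v :- p) := d :* (s :- s :* v) :- s :* (d :* p)) refl s d v ((s - 1#) * r) ⟩
        d * (s - s * v) - s * (d * ((s - 1#) * r))
          ≈⟨ +-cong (*-congˡ (+-congˡ (-‿cong sv≈1))) (-‿cong (*-congˡ d[s-1]r≈1)) ⟩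
        (s + 1#) * i * (s - 1#) - s * 1#
          ≈⟨ solve 2 (λ s i → (s :+ :1) :* i :* (s :- :1) :- s :* :1 := (s :+ :1) :* ((s :- :1) :* i) :- s) refl s i ⟩
        (s + 1#) * ((s - 1#) * i) - s
          ≈⟨ +-congʳ (*-congˡ [s-1]i≈1) ⟩
        (s + 1#) * 1# - s
          ≈⟨ solve 1 (λ s → (s :+ :1) :* :1 :- s := :1) refl s ⟩
        1# ∎

      0<n̂ : 0# < n̂
      0<n̂ = fromℕ-pos N

      -- `u₀` and -l₀ are the dimension divided by εᵁ = 1/(s d) and by v = 1/s, so that with no edge
      -- selected both potentials equal their bounds.
      u₀ l₀ u l m̂ : Carrier
      u₀ = n̂ * (s * d)
      l₀ = - (n̂ * s)
      m̂ = fromℕ m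
      u = u₀ + m̂ * d
      l = l₀ + m̂

      initially : Between u₀ l₀ εᵁ v d s 0<d v<1 1<s sv≈1 balance 0 (λ _ → 0#)
      initially =
        Barrier-cong (λ e → solve 3 (λ u w d → u :* w := (u :+ :0 :* d) :* w :- :0) refl u₀ (w e) d)
          (initial u₀ εᵁ (*-pos 0<n̂ (*-pos 0<s 0<d))
            (≤-reflexive (sym (trans (*-assoc n̂ (s * d) εᵁ) (trans (*-congˡ sdεᵁ≈1) (*-identityʳ n̂)))))) ,
        Barrier-cong (λ e → solve 2 (λ a w → a :* w := :0 :- (:- a :+ :0) :* w) refl (n̂ * s) (w e))
          (initial (n̂ * s) v (*-pos 0<n̂ 0<s)
            (≤-reflexive (sym (trans (*-assoc n̂ s v) (trans (*-congˡ sv≈1) (*-identityʳ n̂))))))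

      final : ∃ λ (τ : Selection w) → count (support τ) ℕ.≤ m × Between u₀ l₀ εᵁ v d s 0<d v<1 1<s sv≈1 balance m (coeff τ)
      final = iterate u₀ l₀ εᵁ v d s 0<d v<1 1<s sv≈1 balance initially m

      τ : Selection w
      τ = proj₁ final
      t : Vector Carrier K
      t = coeff τ

      0<l : 0# < l
      0<l = <-≤-trans
        (<-respʳ-≈ (solve 2 (λ n s → n :* (s :* (s :- :1)) := :- (n :* s) :+ n :* (s :* s)) refl n̂ s)
          (*-pos 0<n̂ (*-pos 0<s 0<s-1)))
        (+-monoʳ-≤ l₀ ns²≤m)

      λ′ : Carrier
      λ′ = proj₁ (reciprocal 0<l)
      0<λ : 0# < λ′
      0<λ = proj₁ (proj₂ (reciprocal 0<l))
      λl≈1 : λ′ * l ≈ 1#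
      λl≈1 = trans (*-comm λ′ l) (proj₂ (proj₂ (reciprocal 0<l)))

      lM≤ : ∀ x → l * M x x ≤ form t x x
      lM≤ x = 0≤y-x⇒x≤y (≤-resp refl eq (Barrier.psd (proj₂ (proj₂ (proj₂ final))) x))
        where
        eq : form (λ e → t e - l * w e) x x ≈ form t x x - l * M x x
        eq = trans (form-cong (λ e → solve 3 (λ t l w → t :- l :* w := t :+ :- l :* w) refl (t e) l (w e)) x x)
          (trans (form-linear-coeff t (- l) w x x) (+-congˡ (solve 2 (λ l m → :- l :* m := :- (l :* m)) refl l (M x x))))

      ≤uM : ∀ x → form t x x ≤ u * M x x
      ≤uM x = 0≤y-x⇒x≤y (≤-resp refl eq (Barrier.psd (proj₁ (proj₂ (proj₂ final))) x))
        where
        eq : form (λ e → u * w e - t e) x x ≈ u * M x x - form t x x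
        eq = trans (form-cong (λ e → solve 3 (λ t u w → u :* w :- t := u :* w :+ :- :1 :* t) refl (t e) u (w e)) x x)
          (trans (form-linear-coeff (λ e → u * w e) (- 1#) t x x)
            (trans (+-congʳ (form-scale u w x x)) (solve 2 (λ a b → a :+ :- :1 :* b := a :- b) refl (u * M x x) (form t x x))))

      -- Multiplied by (s - 1)², the difference κ l - u becomes 2 (s + 1)(m - n̂ s²). The factor κ
      -- is thus exact at m = n̂ s², and rounding the number of steps up does no harm.
      u≤κl : u ≤ κ * l
      u≤κl = *-cancelˡ-≤ (*-pos 0<s-1 0<s-1) (0≤y-x⇒x≤y (≤-resp refl (sym eq)
        (*-nonneg (<⇒≤ 0<s+1) (+-nonneg (x≤y⇒0≤y-x ns²≤m) (x≤y⇒0≤y-x ns²≤m)))))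
        where
        eq : (s - 1#) * (s - 1#) * (κ * l) - (s - 1#) * (s - 1#) * u ≈ (s + 1#) * ((m̂ - n̂ * (s * s)) + (m̂ - n̂ * (s * s)))
        eq = begin
          (s - 1#) * (s - 1#) * (κ * l) - (s - 1#) * (s - 1#) * u
            ≈⟨ solve 6 (λ s κ l n i m →
                 (s :- :1) :* (s :- :1) :* (κ :* l) :- (s :- :1) :* (s :- :1) :* (n :* (s :* ((s :+ :1) :* i)) :+ m :* ((s :+ :1) :* i))
                 := (s :- :1) :* (s :- :1) :* κ :* l :- (s :- :1) :* (s :+ :1) :* (n :* s :+ m) :* ((s :- :1) :* i)) refl s κ l n̂ i m̂ ⟩
          (s - 1#) * (s - 1#) * κ * l - (s - 1#) * (s + 1#) * (n̂ * s + m̂) * ((s - 1#) * i)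
            ≈⟨ +-cong (*-congʳ κ-eq) (-‿cong (*-congˡ [s-1]i≈1)) ⟩
          (s + 1#) * (s + 1#) * l - (s - 1#) * (s + 1#) * (n̂ * s + m̂) * 1#
            ≈⟨ solve 3 (λ s n m → (s :+ :1) :* (s :+ :1) :* (:- (n :* s) :+ m) :- (s :- :1) :* (s :+ :1) :* (n :* s :+ m) :* :1
                 := (s :+ :1) :* ((m :- n :* (s :* s)) :+ (m :- n :* (s :* s)))) refl s n̂ m̂ ⟩
          (s + 1#) * ((m̂ - n̂ * (s * s)) + (m̂ - n̂ * (s * s))) ∎

      λκl : ∀ x → λ′ * (κ * l * M x x) ≈ κ * M x x
      λκl x = trans (solve 4 (λ a κ l m → a :* (κ :* l :* m) := (a :* l) :* (κ :* m)) refl λ′ κ l (M x x))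
        (trans (*-congʳ λl≈1) (*-identityˡ _))

-- Double sums as sums over a product index.

module SumOverPairs {a ℓ} (R : Semiring a ℓ) where
  open Semiring R hiding (zero)
  open import Algebra.Properties.Semiring.Sum R using (sum; sum-cong-≋)

  sum-++ : ∀ m {n} (g : Fin (m ℕ.+ n) → Carrier) → sum g ≈ sum (λ i → g (i ↑ˡ n)) + sum (λ j → g (m ↑ʳ j))
  sum-++ zero    g = sym (+-identityˡ (sum g))
  sum-++ (suc m) g = trans (+-congˡ (sum-++ m (g ∘ fsuc))) (sym (+-assoc _ _ _))

  sum-combine : ∀ m {n} (g : Fin (m ℕ.* n) → Carrier) → sum g ≈ sum λ i → sum λ j → g (combine {m} {n} i j)
  sum-combine zero        g = refl
  sum-combine (suc m) {n} g = trans (sum-++ n g) (+-congˡ (sum-combine m (λ k → g (n ↑ʳ k))))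

  sum-pairs-cong : ∀ {m n} (g h : Fin m → Fin n → Carrier) → (∀ u v → g u v ≈ h u v) →
    sum (λ u → sum (g u)) ≈ sum (λ u → sum (h u))
  sum-pairs-cong g h g≈h = sum-cong-≋ λ u → sum-cong-≋ (g≈h u)

-- Connected graphs in grounded coordinates.

module ConnectedGraphs {c₀ ℓ₁ ℓ₂} (ℝ : RealNumbers c₀ ℓ₁ ℓ₂) where
  open GraphsOver ℝ
  open WeightedGraph
  open OrderedField ℝ
  open WeightedForms ℝ
  open Sparsifiers ℝ
  open TwiceRamanujan ℝ
  open import Data.Vec.Functional using (_∷_)
  open import Relation.Binary.Reasoning.Setoid setoid
  private
    module ∑ℕ = SemiringSum ℕ.+-*-semiring
    module Pairsℝ = SumOverPairs semiring
    module Pairsℕ = SumOverPairs ℕ.+-*-semiring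

  square-difference : ∀ {n} → Vector Carrier n → Fin n → Fin n → Carrier
  square-difference x u v = (x u - x v) * (x u - x v)

  #⇒0<[x-y]² : ∀ {x y} → x # y → 0# < (x - y) * (x - y)
  #⇒0<[x-y]² {x} {y} x#y with #⇒<⊎> x#y
  ... | inj₁ x<y = <-respʳ-≈ (solve 2 (λ x y → (y :- x) :* (y :- x) := (x :- y) :* (x :- y)) refl x y) (*-pos (x<y⇒0<y-x x<y) (x<y⇒0<y-x x<y))
  ... | inj₂ y<x = *-pos (x<y⇒0<y-x y<x) (x<y⇒0<y-x y<x)

  -- Connectedness without paths, in the form that makes the grounded Laplacian definite.
  Connected : ∀ {n} → WeightedGraph n → Set (c₀ ⊔ ℓ₂)
  Connected {n} G = ∀ (x : Vector Carrier n) u v → x u # x v → ∃₂ λ a b → adj G a b ≡ true × x a # x b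

  Sparsifier : ∀ {n} → WeightedGraph n → ℕ → Carrier → Set (c₀ ⊔ ℓ₁ ⊔ ℓ₂)
  Sparsifier {n} G m κ = ∃ λ (H : WeightedGraph n) → (H ⊆ᴱ G) × (numEdges H ℕ.≤ m) ×
    (∀ (x : Vector Carrier n) →
      (quadForm (laplacian G) x ≤ quadForm (laplacian H) x) ×
      (quadForm (laplacian H) x ≤ κ * quadForm (laplacian G) x))

  module Grounded {N : ℕ} (G : WeightedGraph (suc (suc N))) where
    n K : ℕ
    n = suc (suc N)
    K = n ℕ.* n

    -- Coordinates relative to vertex 0; the functional of the pair (u , v) is x u - x v.
    incidence : Fin n × Fin n → Vector Carrier (suc N)
    incidence (u , v) i = δ u (fsuc i) - δ v (fsuc i)

    -- All ordered pairs serve as indices, which avoids enumerating the edges. Pairs that are not an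
    -- edge with u < v get weight 0, and a `Selection` cannot contain them because it demands
    -- `0 < w e`.
    pairWeight : Fin n × Fin n → Carrier
    pairWeight (u , v) = if isEdge G u v then weight G u v else 0#

    b : Fin K → Vector Carrier (suc N)
    b e = incidence (remQuot {n} n e)

    w : Vector Carrier K
    w e = pairWeight (remQuot {n} n e)

    open Forms b using (f; form)

    w-combine : ∀ u v → w (combine u v) ≡ pairWeight (u , v)
    w-combine u v = ≡.cong pairWeight (remQuot-combine u v)

    isEdge⇒adj : ∀ u v → isEdge G u v ≡ true → adj G u v ≡ true
    isEdge⇒adj u v eq with does (u <? v)
    ... | true = eq

    pairWeight-nonneg : ∀ p → 0# ≤ pairWeight p
    pairWeight-nonneg (u , v) with isEdge G u v in eq
    ... | true  = <⇒≤ (weight-pos G u v (isEdge⇒adj u v eq))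
    ... | false = ≤-refl

    0<pairWeight⇒isEdge : ∀ u v → 0# < pairWeight (u , v) → isEdge G u v ≡ true
    0<pairWeight⇒isEdge u v 0<w with isEdge G u v
    ... | true  = ≡.refl
    ... | false = ⊥-elim (<-irrefl {0#} {0#} refl 0<w)

    0≤w : ∀ e → 0# ≤ w e
    0≤w e = pairWeight-nonneg (remQuot {n} n e)

    incidence-dot : ∀ u v (y : Vector Carrier (suc N)) → sum (λ i → incidence (u , v) i * y i) ≈ (0# ∷ y) u - (0# ∷ y) v
    incidence-dot u v y = begin
      sum (λ i → (δ u (fsuc i) - δ v (fsuc i)) * y i)
        ≈⟨ sum-cong-≋ (λ i → solve 3 (λ p q y → (p :- q) :* y := p :* y :+ :- :1 :* (q :* y)) refl (δ u (fsuc i)) (δ v (fsuc i)) (y i)) ⟩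
      sum (λ i → δ u (fsuc i) * y i + - 1# * (δ v (fsuc i) * y i))
        ≈⟨ sum-linear (- 1#) (λ i → δ u (fsuc i) * y i) (λ i → δ v (fsuc i) * y i) ⟩
      sum (λ i → δ u (fsuc i) * y i) + - 1# * sum (λ i → δ v (fsuc i) * y i)
        ≈⟨ +-cong (coordinate u) (*-congˡ (coordinate v)) ⟩
      (0# ∷ y) u + - 1# * (0# ∷ y) v
        ≈⟨ solve 2 (λ x z → x :+ :- :1 :* z := x :- z) refl ((0# ∷ y) u) ((0# ∷ y) v) ⟩
      (0# ∷ y) u - (0# ∷ y) v ∎
      where
      coordinate : ∀ u → sum (λ i → δ u (fsuc i) * y i) ≈ (0# ∷ y) u
      coordinate u = begin
        sum (λ i → δ u (fsuc i) * y i)                        ≈⟨ +-identityˡ _ ⟨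
        0# + sum (λ i → δ u (fsuc i) * y i)                   ≈⟨ +-congʳ (zeroʳ (δ u fzero)) ⟨
        δ u fzero * 0# + sum (λ i → δ u (fsuc i) * y i)       ≈⟨ sum-δ u (0# ∷ y) ⟩
        (0# ∷ y) u                                            ∎

    f-combine : ∀ u v (y : Vector Carrier (suc N)) → f (combine u v) y ≈ (0# ∷ y) u - (0# ∷ y) v
    f-combine u v y = trans
      (reflexive (≡.cong (λ p → sum λ i → incidence p i * y i) (remQuot-combine u v)))
      (incidence-dot u v y)

    ground : Vector Carrier n → Vector Carrier (suc N)
    ground x i = x (fsuc i) - x fzero

    f-ground : ∀ u v x → f (combine u v) (ground x) ≈ x u - x v
    f-ground u v x = begin
      f (combine u v) (ground x)                       ≈⟨ f-combine u v (ground x) ⟩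
      (0# ∷ ground x) u - (0# ∷ ground x) v            ≈⟨ +-cong (relative u) (-‿cong (relative v)) ⟩
      (x u - x fzero) - (x v - x fzero)                ≈⟨ solve 3 (λ p q z → (p :- z) :- (q :- z) := p :- q) refl (x u) (x v) (x fzero) ⟩
      x u - x v                                        ∎
      where
      relative : ∀ u → (0# ∷ ground x) u ≈ x u - x fzero
      relative fzero    = sym (-‿inverseʳ (x fzero))
      relative (fsuc u) = refl

    form-ground : ∀ c x → form c (ground x) (ground x) ≈
      sum λ u → sum λ v → c (combine u v) * square-difference x u v
    form-ground c x = trans
      (Pairsℝ.sum-combine n {n} (λ e → c e * (f e (ground x) * f e (ground x))))
      (Pairsℝ.sum-pairs-cong (λ u v → c (combine u v) * (f (combine u v) (ground x) * f (combine u v) (ground x)))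
        (λ u v → c (combine u v) * square-difference x u v)
        (λ u v → *-congˡ (*-cong (f-ground u v x) (f-ground u v x))))

    form-w : ∀ x → form w (ground x) (ground x) ≈ quadForm (laplacian G) x
    form-w x = begin
      form w (ground x) (ground x)
        ≈⟨ form-ground w x ⟩
      sum (λ u → sum λ v → w (combine u v) * square-difference x u v)
        ≈⟨ Pairsℝ.sum-pairs-cong (λ u v → w (combine u v) * square-difference x u v)
             (λ u v → if isEdge G u v then weight G u v * square-difference x u v else 0#)
             (λ u v → trans (*-congʳ (reflexive (w-combine u v))) (if-* (isEdge G u v) (weight G u v) (square-difference x u v))) ⟩
      sum (λ u → sum λ v → if isEdge G u v then weight G u v * square-difference x u v else 0#)
        ≈⟨ laplacian-form G x ⟨
      quadForm (laplacian G) x ∎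
      where
      if-* : ∀ c p q → (if c then p else 0#) * q ≈ (if c then p * q else 0#)
      if-* true  p q = refl
      if-* false p q = zeroˡ q

    -- `Connected` is applied to y extended by 0 at the grounded vertex. A coordinate apart from 0
    -- separates its vertex from the grounded one, so some edge has apart ends and contributes a
    -- positive summand.
    definite : Connected G → Forms.Definite b w
    definite connected y (i , yᵢ#0) = sum-pos (λ e → w e * (f e y * f e y)) (λ e → *-nonneg (0≤w e) (0≤x² (f e y)))
      (proj₁ separated) (proj₂ separated)
      where
      along : ∀ u v → u <ᶠ v → adj G u v ≡ true → (0# ∷ y) u # (0# ∷ y) v → ∃ λ e → 0# < w e * (f e y * f e y)
      along u v u<v uv x#y = combine u v , *-pos
        (<-respʳ-≈ (reflexive (≡.sym (≡.trans (w-combine u v) (≡.cong (if_then weight G u v else 0#) edge)))) (weight-pos G u v uv))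
        (<-respʳ-≈ (*-cong (sym (f-combine u v y)) (sym (f-combine u v y))) (#⇒0<[x-y]² x#y))
        where
        edge : isEdge G u v ≡ true
        edge = ≡.cong₂ _∧_ (dec-true (u <? v) u<v) uv
      separated : ∃ λ e → 0# < w e * (f e y * f e y)
      separated = oriented (connected (0# ∷ y) (fsuc i) fzero yᵢ#0)
        where
        oriented : (∃₂ λ u v → adj G u v ≡ true × (0# ∷ y) u # (0# ∷ y) v) → ∃ λ e → 0# < w e * (f e y * f e y)
        oriented (u , v , uv , x#y) with <-cmp u v
        ... | tri< u<v _ _ = along u v u<v uv x#y
        ... | tri> _ _ v<u = along v u v<u (≡.trans (adj-sym G v u) uv) (#-sym x#y)
        ... | tri≈ _ ≡.refl _ with () ← ≡.trans (≡.sym uv) (adj-irrefl G u)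

    module FromSelection (τ : Selection w) where
      open Selection τ

      S : Fin n → Fin n → Bool
      S u v = support (combine u v)

      t : Fin n → Fin n → Carrier
      t u v = coeff (combine u v)

      S⇒isEdge : ∀ u v → S u v ≡ true → isEdge G u v ≡ true
      S⇒isEdge u v eq = 0<pairWeight⇒isEdge u v (<-respʳ-≈ (reflexive (w-combine u v)) (proj₂ (pos (combine u v) eq)))

      S⇒< : ∀ u v → S u v ≡ true → u <ᶠ v
      S⇒< u v eq with u <? v
      ... | yes u<v = u<v
      ... | no  u≮v with () ← ≡.trans (≡.sym (S⇒isEdge u v eq)) (≡.cong (_∧ adj G u v) (dec-false (u <? v) u≮v))

      S-false : ∀ u v → (u <ᶠ v → ⊥) → S u v ≡ false
      S-false u v u≮v with S u v in eq
      ... | false = ≡.refl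
      ... | true  = ⊥-elim (u≮v (S⇒< u v eq))

      H : WeightedGraph n
      H = record
        { adj        = λ u v → S u v ∨ S v u
        ; adj-sym    = λ u v → ∨-comm (S u v) (S v u)
        ; adj-irrefl = λ u → ≡.cong₂ _∨_ (S-false u u (<ᶠ-irrefl ≡.refl)) (S-false u u (<ᶠ-irrefl ≡.refl))
        -- Only the orientation u < v carries a coefficient; adding that of the opposite pair, which
        -- is 0, makes the weight symmetric.
        ; weight     = λ u v → t u v + t v u
        ; weight-sym = λ u v _ → +-comm (t u v) (t v u)
        ; weight-pos = positive
        }
        where
        positive : ∀ u v → S u v ∨ S v u ≡ true → 0# < t u v + t v u
        positive u v eq with S u v in eq′
        ... | true  = +-pos-nonneg (proj₁ (pos (combine u v) eq′)) (nonneg (combine v u))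
        ... | false = +-nonneg-pos (nonneg (combine u v)) (proj₁ (pos (combine v u) eq))

      H⊆G : H ⊆ᴱ G
      H⊆G u v eq with S u v in eq′
      ... | true  = isEdge⇒adj u v (S⇒isEdge u v eq′)
      ... | false = ≡.trans (adj-sym G u v) (isEdge⇒adj v u (S⇒isEdge v u eq))

      isEdge-H : ∀ u v → isEdge H u v ≡ S u v
      isEdge-H u v with u <? v
      ... | yes u<v rewrite dec-true (u <? v) u<v | S-false v u (<ᶠ-asym u<v) = ∨-identityʳ (S u v)
      ... | no  u≮v rewrite dec-false (u <? v) u≮v = ≡.sym (S-false u v u≮v)

      numEdges-H : numEdges H ≡ count support
      numEdges-H = ≡.trans {j = ∑ℕ.sum λ u → ∑ℕ.sum λ v → if S u v then 1 else 0}
        (Pairsℕ.sum-pairs-cong (λ u v → if isEdge H u v then 1 else 0) (λ u v → if S u v then 1 else 0)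
          (λ u v → ≡.cong (if_then 1 else 0) (isEdge-H u v)))
        (≡.sym (Pairsℕ.sum-combine n {n} (λ e → if support e then 1 else 0)))

      form-t : ∀ x → form coeff (ground x) (ground x) ≈ quadForm (laplacian H) x
      form-t x = begin
        form coeff (ground x) (ground x)
          ≈⟨ form-ground coeff x ⟩
        sum (λ u → sum λ v → t u v * square-difference x u v)
          ≈⟨ Pairsℝ.sum-pairs-cong (λ u v → t u v * square-difference x u v)
               (λ u v → if isEdge H u v then weight H u v * square-difference x u v else 0#)
               (λ u v → sym (term u v (square-difference x u v))) ⟩
        sum (λ u → sum λ v → if isEdge H u v then weight H u v * square-difference x u v else 0#)
          ≈⟨ laplacian-form H x ⟨
        quadForm (laplacian H) x ∎
        where
        term : ∀ u v q → (if isEdge H u v then (t u v + t v u) * q else 0#) ≈ t u v * q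
        term u v q rewrite isEdge-H u v with S u v in eq
        ... | true  = *-congʳ (trans (+-congˡ (zeros (combine v u) (S-false v u (<ᶠ-asym (S⇒< u v eq))))) (+-identityʳ _))
        ... | false = sym (trans (*-congʳ (zeros (combine u v) eq)) (zeroˡ q))

    sparsify-connected : Connected G → ∀ s κ → 1# < s → (s - 1#) * (s - 1#) * κ ≈ (s + 1#) * (s + 1#) →
      ∀ m → fromℕ (suc N) * (s * s) ≤ fromℕ m →
      Sparsifier G m κ
    sparsify-connected connected s κ 1<s κ-eq m N≤m = build (sparsify b w 0≤w (definite connected) s κ 1<s κ-eq m N≤m)
      where
      build : (∃ λ (τ : Selection w) → count (Selection.support τ) ℕ.≤ m ×
          (∀ x → form w x x ≤ form (Selection.coeff τ) x x × form (Selection.coeff τ) x x ≤ κ * form w x x)) → Sparsifier G m κ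
      build (τ , count≤m , bounds) = H , H⊆G , ℕ.≤-trans (ℕ.≤-reflexive numEdges-H) count≤m , λ x →
          ≤-resp (form-w x) (form-t x) (proj₁ (bounds (ground x)))
        , ≤-resp (form-t x) (*-congˡ (form-w x)) (proj₂ (bounds (ground x)))
        where open FromSelection τ

-- Counting edges and degrees.

module EdgeCounts {c₀ ℓ₁ ℓ₂} (ℝ : RealNumbers c₀ ℓ₁ ℓ₂) where
  open GraphsOver ℝ using (WeightedGraph; isEdge; numEdges; degree)
  open WeightedGraph
  private
    module Pairsℕ = SumOverPairs ℕ.+-*-semiring
    module ∑ℕ = SemiringSum ℕ.+-*-semiring

  sumℕ-mono : ∀ {n} {g h : Fin n → ℕ} → (∀ i → g i ℕ.≤ h i) → ∑ℕ.sum g ℕ.≤ ∑ℕ.sum h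
  sumℕ-mono {zero}  g≤h = ℕ.z≤n
  sumℕ-mono {suc n} g≤h = ℕ.+-mono-≤ (g≤h fzero) (sumℕ-mono (g≤h ∘ fsuc))

  handshake : ∀ {n} (G : WeightedGraph n) → ∑ℕ.sum (degree G) ≡ numEdges G ℕ.+ numEdges G
  handshake {n} G = begin
    ∑ℕ.sum (λ u → ∑ℕ.sum λ v → if adj G u v then 1 else 0)
      ≡⟨ Pairsℕ.sum-pairs-cong (λ u v → if adj G u v then 1 else 0) (λ u v → up u v ℕ.+ up v u) split ⟩
    ∑ℕ.sum (λ u → ∑ℕ.sum λ v → up u v ℕ.+ up v u)
      ≡⟨ ∑ℕ.sum-cong-≋ (λ u → ∑ℕ.∑-distrib-+ (up u) (λ v → up v u)) ⟩
    ∑ℕ.sum (λ u → ∑ℕ.sum (up u) ℕ.+ ∑ℕ.sum (λ v → up v u))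
      ≡⟨ ∑ℕ.∑-distrib-+ (λ u → ∑ℕ.sum (up u)) (λ u → ∑ℕ.sum (λ v → up v u)) ⟩
    numEdges G ℕ.+ ∑ℕ.sum (λ u → ∑ℕ.sum λ v → up v u)
      ≡⟨ ≡.cong (numEdges G ℕ.+_) (∑ℕ.∑-comm (λ u v → up v u)) ⟩
    numEdges G ℕ.+ numEdges G ∎
    where
    open ≡.≡-Reasoning
    up : Fin n → Fin n → ℕ
    up u v = if isEdge G u v then 1 else 0
    split : ∀ u v → (if adj G u v then 1 else 0) ≡ up u v ℕ.+ up v u
    split u v with <-cmp u v
    ... | tri< u<v _ v≮u rewrite dec-true (u <? v) u<v | dec-false (v <? u) v≮u = ≡.sym (ℕ.+-identityʳ _)
    ... | tri> u≮v _ v<u rewrite dec-false (u <? v) u≮v | dec-true (v <? u) v<u | adj-sym G u v = ≡.refl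
    ... | tri≈ u≮u ≡.refl _ rewrite dec-false (u <? u) u≮u | adj-irrefl G u = ≡.refl

-- Reduction to connected graphs.

module Components {c₀ ℓ₁ ℓ₂} (ℝ : RealNumbers c₀ ℓ₁ ℓ₂) where
  open GraphsOver ℝ
  open WeightedGraph
  open OrderedField ℝ
  open ConnectedGraphs ℝ
  open EdgeCounts ℝ
  open import Data.List.Base using (List; []; _∷_; filter; allFin; cartesianProduct)
  open import Data.List.Membership.Propositional using (_∈_)
  open import Data.List.Membership.Propositional.Properties using (∈-filter⁺; ∈-filter⁻; ∈-cartesianProduct⁺; ∈-allFin)
  open import Data.List.Relation.Unary.Any using (here; there)
  open import Relation.Binary.Reasoning.Setoid setoid
  open import Algebra.Properties.Semiring.Mult semiring using (×-homo-+)
  private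
    module Pairsℝ = SumOverPairs semiring
    module Pairsℕ = SumOverPairs ℕ.+-*-semiring
    module ∑ℕ = SemiringSum ℕ.+-*-semiring

  -- Components are given by representatives, which makes membership decidable. `closed` says that
  -- no edge leaves a class; `separated` says that a class is connected, in the same path-free form
  -- as `Connected`. Inserting an edge merges two classes, as in union-find.
  record Components {n : ℕ} (E : List (Fin n × Fin n)) : Set (c₀ ⊔ ℓ₂) where
    field
      root       : Fin n → Fin n
      idempotent : ∀ u → root (root u) ≡ root u
      closed     : ∀ {u v} → (u , v) ∈ E → root u ≡ root v
      separated  : ∀ (x : Vector Carrier n) u v → root u ≡ root v → x u # x v →
                   ∃₂ λ a b → (a , b) ∈ E × x a # x b

  components : ∀ {n} (E : List (Fin n × Fin n)) → Components E
  components []            = record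
    { root       = λ u → u
    ; idempotent = λ u → ≡.refl
    ; closed     = λ ()
    ; separated  = λ { x u .u ≡.refl x#x → ⊥-elim (#-irrefl refl x#x) }
    }
  components {n} ((a , b) ∷ E) = record
    { root       = root
    ; idempotent = idempotent
    ; closed     = closed
    ; separated  = separated
    }
    where
    module C = Components (components E)

    root : Fin n → Fin n
    root u with C.root u ≟ C.root b
    ... | yes _ = C.root a
    ... | no  _ = C.root u

    root-yes : ∀ u → C.root u ≡ C.root b → root u ≡ C.root a
    root-yes u eq with C.root u ≟ C.root b
    ... | yes _ = ≡.refl
    ... | no ¬eq = ⊥-elim (¬eq eq)

    root-no : ∀ u → C.root u ≢ C.root b → root u ≡ C.root u
    root-no u ¬eq with C.root u ≟ C.root b
    ... | yes eq = ⊥-elim (¬eq eq)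
    ... | no  _  = ≡.refl

    root-cong : ∀ {u v} → C.root u ≡ C.root v → root u ≡ root v
    root-cong {u} {v} eq with C.root u ≟ C.root b
    ... | yes eq′ = ≡.sym (root-yes v (≡.trans (≡.sym eq) eq′))
    ... | no ¬eq′ = ≡.trans eq (≡.sym (root-no v (λ eq′ → ¬eq′ (≡.trans eq eq′))))

    root-a : root a ≡ C.root a
    root-a with C.root a ≟ C.root b
    ... | yes _ = ≡.refl
    ... | no  _ = ≡.refl

    idempotent : ∀ u → root (root u) ≡ root u
    idempotent u with C.root u ≟ C.root b
    ... | yes _ = ≡.trans (root-cong (C.idempotent a)) root-a
    ... | no ¬eq = ≡.trans (root-cong (C.idempotent u)) (root-no u ¬eq)

    closed : ∀ {u v} → (u , v) ∈ ((a , b) ∷ E) → root u ≡ root v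
    closed (here ≡.refl) = ≡.trans root-a (≡.sym (root-yes b ≡.refl))
    closed (there uv∈E)  = root-cong (C.closed uv∈E)

    weaken : ∀ {x : Vector Carrier n} → (∃₂ λ u v → (u , v) ∈ E × x u # x v) →
      ∃₂ λ u v → (u , v) ∈ ((a , b) ∷ E) × x u # x v
    weaken (u , v , uv∈E , x#) = u , v , there uv∈E , x#

    -- Think of a path from u through b and a to v: cotransitivity at `x b` and `x a` tells on which
    -- of its three pieces x changes.
    through : ∀ (x : Vector Carrier n) u v → C.root u ≡ C.root b → C.root v ≡ C.root a → x u # x v →
      ∃₂ λ u v → (u , v) ∈ ((a , b) ∷ E) × x u # x v
    through x u v u~b v~a x# with #-cotrans x# (x b)
    ... | inj₁ u#b = weaken (C.separated x u b u~b u#b)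
    ... | inj₂ b#v with #-cotrans b#v (x a)
    ...   | inj₁ b#a = a , b , here ≡.refl , #-sym b#a
    ...   | inj₂ a#v = weaken (C.separated x a v (≡.sym v~a) a#v)

    separated : ∀ (x : Vector Carrier n) u v → root u ≡ root v → x u # x v →
      ∃₂ λ u v → (u , v) ∈ ((a , b) ∷ E) × x u # x v
    separated x u v eq x# with C.root u ≟ C.root b | C.root v ≟ C.root b
    ... | yes u~b | yes v~b = weaken (C.separated x u v (≡.trans u~b (≡.sym v~b)) x#)
    ... | yes u~b | no  _   = through x u v u~b (≡.sym eq) x#
    ... | no  _   | yes v~b = through x v u v~b eq (#-sym x#)
    ... | no  _   | no  _   = weaken (C.separated x u v eq x#)

  module Augmentation {n : ℕ} (G : WeightedGraph n) where

    adjacent? : ∀ (p : Fin n × Fin n) → Dec (adj G (proj₁ p) (proj₂ p) ≡ true)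
    adjacent? p = adj G (proj₁ p) (proj₂ p) ≟ᵇ true

    edges : List (Fin n × Fin n)
    edges = filter adjacent? (cartesianProduct (allFin n) (allFin n))

    open Components (components edges)

    adj⇒same-root : ∀ u v → adj G u v ≡ true → root u ≡ root v
    adj⇒same-root u v uv = closed (∈-filter⁺ adjacent? (∈-cartesianProduct⁺ (∈-allFin u) (∈-allFin v)) uv)

    -- Every two distinct roots are joined. The number of added edges is harmless, as the size of
    -- the sparsifier is governed by the number of vertices.
    bridge : Fin n → Fin n → Bool
    bridge u v = (does (root u ≟ u) ∧ does (root v ≟ v)) ∧ not (does (u ≟ v))

    bridge-sym : ∀ u v → bridge u v ≡ bridge v u
    bridge-sym u v = ≡.cong₂ (λ p q → p ∧ not q) (∧-comm (does (root u ≟ u)) (does (root v ≟ v))) ≟-sym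
      where
      ≟-sym : does (u ≟ v) ≡ does (v ≟ u)
      ≟-sym with u ≟ v
      ... | yes ≡.refl = ≡.sym (dec-true (u ≟ u) ≡.refl)
      ... | no  u≢v    = ≡.sym (dec-false (v ≟ u) (u≢v ∘ ≡.sym))

    bridge⇒roots : ∀ u v → bridge u v ≡ true → root u ≡ u × root v ≡ v
    bridge⇒roots u v eq with root u ≟ u | root v ≟ v
    ... | yes ru | yes rv = ru , rv

    augmented : WeightedGraph n
    augmented = record
      { adj        = λ u v → adj G u v ∨ bridge u v
      ; adj-sym    = λ u v → ≡.cong₂ _∨_ (adj-sym G u v) (bridge-sym u v)
      ; adj-irrefl = irreflexive
      ; weight     = λ u v → if adj G u v then weight G u v else 1#
      ; weight-sym = λ u v _ → symmetric u v
      ; weight-pos = λ u v _ → positive u v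
      }
      where
      irreflexive : ∀ u → adj G u u ∨ bridge u u ≡ false
      irreflexive u rewrite adj-irrefl G u | dec-true (u ≟ u) ≡.refl = ∧-zeroʳ (does (root u ≟ u) ∧ does (root u ≟ u))
      symmetric : ∀ u v → (if adj G u v then weight G u v else 1#) ≈ (if adj G v u then weight G v u else 1#)
      symmetric u v rewrite adj-sym G v u with adj G u v in eq
      ... | true  = weight-sym G u v eq
      ... | false = refl
      positive : ∀ u v → 0# < (if adj G u v then weight G u v else 1#)
      positive u v with adj G u v in eq
      ... | true  = weight-pos G u v eq
      ... | false = 0<1

    along-edge : ∀ {x : Vector Carrier n} → (∃₂ λ a b → (a , b) ∈ edges × x a # x b) →
      ∃₂ λ a b → adj augmented a b ≡ true × x a # x b
    along-edge (a , b , ab∈E , a#b) = a , b , ≡.cong (_∨ bridge a b) ab , a#b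
      where
      ab : adj G a b ≡ true
      ab = proj₂ (∈-filter⁻ adjacent? {xs = cartesianProduct (allFin n) (allFin n)} ab∈E)

    -- Go from u to its root, across a bridge to the root of v, then to v; cotransitivity picks a
    -- piece on which x changes.
    augmented-connected : Connected augmented
    augmented-connected x u v u#v with #-cotrans u#v (x (root u))
    ... | inj₁ u#ru = along-edge (separated x u (root u) (≡.sym (idempotent u)) u#ru)
    ... | inj₂ ru#v with #-cotrans ru#v (x (root v))
    ...   | inj₂ rv#v = along-edge (separated x (root v) v (idempotent v) rv#v)
    ...   | inj₁ ru#rv = root u , root v , ≡.trans (≡.cong (adj G (root u) (root v) ∨_) bridged) (∨-zeroʳ _) , ru#rv
      where
      bridged : bridge (root u) (root v) ≡ true
      bridged = ≡.cong₂ _∧_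
        (≡.cong₂ _∧_ (dec-true (root (root u) ≟ root u) (idempotent u)) (dec-true (root (root v) ≟ root v) (idempotent v)))
        (≡.cong not (dec-false (root u ≟ root v) (λ eq → #-irrefl (reflexive (≡.cong x eq)) ru#rv)))

    recentre : Vector Carrier n → Vector Carrier n
    recentre x u = x u - x (root u)

    -- recentre x vanishes at every root and differs from x by a constant on each component.
    form-recentre : ∀ (A A′ : WeightedGraph n) →
      (∀ u v → adj A u v ≡ adj A′ u v ∧ adj G u v) → A′ ⊆ᴱ augmented →
      (∀ u v → adj A u v ≡ true → weight A u v ≈ weight A′ u v) →
      ∀ x → quadForm (laplacian A) x ≈ quadForm (laplacian A′) (recentre x)
    form-recentre A A′ adj-A A′⊆ weight-A x = begin
      quadForm (laplacian A) x
        ≈⟨ laplacian-form A x ⟩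
      sum (λ u → sum λ v → if isEdge A u v then weight A u v * square-difference x u v else 0#)
        ≈⟨ Pairsℝ.sum-pairs-cong (λ u v → if isEdge A u v then weight A u v * square-difference x u v else 0#)
             (λ u v → if isEdge A′ u v then weight A′ u v * square-difference (recentre x) u v else 0#)
             (λ u v → restrict u v (does (u <? v)) (adj A u v) (adj A′ u v) (adj G u v) ≡.refl ≡.refl ≡.refl) ⟩
      sum (λ u → sum λ v → if isEdge A′ u v then weight A′ u v * square-difference (recentre x) u v else 0#)
        ≈⟨ laplacian-form A′ (recentre x) ⟨
      quadForm (laplacian A′) (recentre x) ∎
      where
      same-root : ∀ u v → root u ≡ root v → square-difference x u v ≈ square-difference (recentre x) u v
      same-root u v eq rewrite eq = solve 3 (λ p q z → (p :- q) :* (p :- q) := ((p :- z) :- (q :- z)) :* ((p :- z) :- (q :- z)))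
        refl (x u) (x v) (x (root v))

      roots : ∀ u v → root u ≡ u × root v ≡ v → square-difference (recentre x) u v ≈ 0#
      roots u v (ru , rv) rewrite ru | rv = solve 2 (λ p q → ((p :- p) :- (q :- q)) :* ((p :- p) :- (q :- q)) := :0) refl (x u) (x v)

      restrict : ∀ u v p a a′ g → adj A u v ≡ a → adj A′ u v ≡ a′ → adj G u v ≡ g →
        (if p ∧ a then weight A u v * square-difference x u v else 0#) ≈
        (if p ∧ a′ then weight A′ u v * square-difference (recentre x) u v else 0#)
      restrict u v false a a′ g a≡ a′≡ g≡ = refl
      restrict u v true a a′ g a≡ a′≡ g≡ with ≡.trans (≡.sym a≡) (≡.trans (adj-A u v) (≡.cong₂ _∧_ a′≡ g≡))
      restrict u v true .false false g    a≡ a′≡ g≡ | ≡.refl = refl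
      restrict u v true .true  true true  a≡ a′≡ g≡ | ≡.refl = *-cong (weight-A u v a≡) (same-root u v (adj⇒same-root u v g≡))
      restrict u v true .false true false a≡ a′≡ g≡ | ≡.refl =
        sym (trans (*-congˡ (roots u v (bridge⇒roots u v bridged))) (zeroʳ _))
        where
        bridged : bridge u v ≡ true
        bridged = ≡.trans (≡.cong (_∨ bridge u v) (≡.sym g≡)) (A′⊆ u v a′≡)

    module Restriction (H′ : WeightedGraph n) (H′⊆ : H′ ⊆ᴱ augmented) where

      H : WeightedGraph n
      H = record
        { adj        = λ u v → adj H′ u v ∧ adj G u v
        ; adj-sym    = λ u v → ≡.cong₂ _∧_ (adj-sym H′ u v) (adj-sym G u v)
        ; adj-irrefl = λ u → ≡.cong (_∧ adj G u u) (adj-irrefl H′ u)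
        ; weight     = weight H′
        ; weight-sym = λ u v eq → weight-sym H′ u v (∧-trueˡ (adj H′ u v) eq)
        ; weight-pos = λ u v eq → weight-pos H′ u v (∧-trueˡ (adj H′ u v) eq)
        }
        where
        ∧-trueˡ : ∀ p {q} → p ∧ q ≡ true → p ≡ true
        ∧-trueˡ true _ = ≡.refl

      H⊆G : H ⊆ᴱ G
      H⊆G u v eq with adj H′ u v
      ... | true = eq

      numEdges-H≤ : numEdges H ℕ.≤ numEdges H′
      numEdges-H≤ = sumℕ-mono λ u → sumℕ-mono λ v → indicator-mono (does (u <? v)) (adj H′ u v) (adj G u v)
        where
        indicator-mono : ∀ p q r → (if p ∧ (q ∧ r) then 1 else 0) ℕ.≤ (if p ∧ q then 1 else 0)
        indicator-mono false q     r     = ℕ.z≤n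
        indicator-mono true  false r     = ℕ.z≤n
        indicator-mono true  true  true  = ℕ.≤-refl
        indicator-mono true  true  false = ℕ.z≤n

      form-H : ∀ x → quadForm (laplacian H) x ≈ quadForm (laplacian H′) (recentre x)
      form-H = form-recentre H H′ (λ u v → ≡.refl) H′⊆ (λ u v _ → refl)

    form-G : ∀ x → quadForm (laplacian G) x ≈ quadForm (laplacian augmented) (recentre x)
    form-G = form-recentre G augmented absorb (λ u v eq → eq) weight-G
      where
      absorb : ∀ u v → adj G u v ≡ (adj G u v ∨ bridge u v) ∧ adj G u v
      absorb u v with adj G u v
      ... | true  = ≡.refl
      ... | false = ≡.sym (∧-zeroʳ (bridge u v))
      weight-G : ∀ u v → adj G u v ≡ true → weight G u v ≈ (if adj G u v then weight G u v else 1#)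
      weight-G u v eq rewrite eq = refl

    restrict-sparsifier : ∀ {m κ} → Sparsifier augmented m κ → Sparsifier G m κ
    restrict-sparsifier {κ = κ} (H′ , H′⊆ , size , bounds) = H , H⊆G , ℕ.≤-trans numEdges-H≤ size , λ x →
        ≤-resp (sym (form-G x)) (sym (form-H x)) (proj₁ (bounds (recentre x)))
      , ≤-resp (sym (form-H x)) (*-congˡ (sym (form-G x))) (proj₂ (bounds (recentre x)))
      where open Restriction H′ H′⊆

  -- Average degree, approximation factor and the final bound.

  fromℕ-+ : ∀ a b → fromℕ (a ℕ.+ b) ≈ fromℕ a + fromℕ b
  fromℕ-+ = ×-homo-+ 1#

  fromℕ-mono : ∀ {a b} → a ℕ.≤ b → fromℕ a ≤ fromℕ b
  fromℕ-mono (ℕ.z≤n {zero})  = ≤-refl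
  fromℕ-mono (ℕ.z≤n {suc b}) = <⇒≤ (fromℕ-pos b)
  fromℕ-mono (ℕ.s≤s a≤b)       = +-monoʳ-≤ 1# (fromℕ-mono a≤b)

  -- The ceiling is below d (n - 1) + 1, which is less than d n because d > 1; by `handshake` the
  -- average degree is twice the number of edges divided by n.
  averageDegree-bound : ∀ {d} → 1# < d → ∀ n .{{_ : NonZero n}} (H : WeightedGraph n) m →
    fromℕ m < d * (fromℕ n - 1#) + 1# → numEdges H ℕ.≤ m → averageDegree H ≤ fromℕ 2 * d
  averageDegree-bound {d} 1<d n@(suc k) H m m<d[n-1]+1 size = *-cancelˡ-≤ 0<n̂ (≤-resp (sym cleared) (sym doubled) (+-mono-≤ E≤dn E≤dn))
    where
    n̂ E : Carrier
    n̂ = fromℕ n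
    E = fromℕ (numEdges H)
    0<n̂ : 0# < n̂
    0<n̂ = fromℕ-pos k
    E≤dn : E ≤ d * n̂
    E≤dn = ≤-trans (fromℕ-mono size) (<⇒≤ (<-trans m<d[n-1]+1 (0<y-x⇒x<y (<-respʳ-≈
      (solve 2 (λ d n → d :- :1 := d :* n :- (d :* (n :- :1) :+ :1)) refl d n̂) (x<y⇒0<y-x 1<d)))))
    doubled : n̂ * (fromℕ 2 * d) ≈ d * n̂ + d * n̂
    doubled = solve 2 (λ n d → n :* ((:1 :+ (:1 :+ :0)) :* d) := d :* n :+ d :* n) refl n̂ d
    cleared : n̂ * averageDegree H ≈ E + E
    cleared = begin
      -- Apartness from 0 yields an inverse of the difference n̂ - 0, hence the inserted
      -- subtraction.
      n̂ * (fromℕ (∑ℕ.sum (degree H)) * v)      ≈⟨ solve 3 (λ n p v → n :* (p :* v) := p :* ((n :- :0) :* v)) refl n̂ (fromℕ (∑ℕ.sum (degree H))) v ⟩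
      fromℕ (∑ℕ.sum (degree H)) * ((n̂ - 0#) * v) ≈⟨ trans (*-congˡ (proj₂ (proj₂ (#⇒invertible (fromℕ#0 n))))) (*-identityʳ _) ⟩
      fromℕ (∑ℕ.sum (degree H))                ≈⟨ reflexive (≡.cong fromℕ (handshake H)) ⟩
      fromℕ (numEdges H ℕ.+ numEdges H)        ≈⟨ fromℕ-+ (numEdges H) (numEdges H) ⟩
      E + E                                    ∎
      where
      v : Carrier
      v = proj₁ (#⇒invertible (fromℕ#0 n))

  -- As d = s², the numerator and denominator of the factor are (s + 1)² and (s - 1)²; `sparsify`
  -- takes this relation cleared of denominators.
  factor-spec : ∀ {d s} (1<d : 1# < d) (s-sqrt : IsSqrt s d) →
    (s - 1#) * (s - 1#) * approximationFactor d s 1<d s-sqrt ≈ (s + 1#) * (s + 1#)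
  factor-spec {d} {s} 1<d s-sqrt@(_ , ss≈d) = begin
    (s - 1#) * (s - 1#) * (num * v)
      ≈⟨ solve 3 (λ s n v → (s :- :1) :* (s :- :1) :* (n :* v) := n :* (((s :* s :+ :1) :- (:1 :+ (:1 :+ :0)) :* s :- :0) :* v)) refl s num v ⟩
    num * (((s * s + 1#) - fromℕ 2 * s - 0#) * v)
      ≈⟨ *-congˡ (*-congʳ (+-congʳ (+-congʳ (+-congʳ ss≈d)))) ⟩
    num * ((den - 0#) * v)
      ≈⟨ *-congˡ (proj₂ (proj₂ (#⇒invertible den#0))) ⟩
    num * 1#
      ≈⟨ trans (*-identityʳ num) (+-congʳ (+-congʳ (sym ss≈d))) ⟩
    (s * s + 1#) + fromℕ 2 * s
      ≈⟨ solve 1 (λ s → (s :* s :+ :1) :+ (:1 :+ (:1 :+ :0)) :* s := (s :+ :1) :* (s :+ :1)) refl s ⟩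
    (s + 1#) * (s + 1#) ∎
    where
    num den v : Carrier
    num = (d + 1#) + fromℕ 2 * s
    den = (d + 1#) - fromℕ 2 * s
    den#0 : den # 0#
    den#0 = denominator#0 1<d s-sqrt
    v = proj₁ (#⇒invertible den#0)

  -- (s + 1)(s - 1) = d - 1 is positive, and so is s + 1.
  1<sqrt : ∀ {d s} → 1# < d → IsSqrt s d → 1# < s
  1<sqrt {d} {s} 1<d (0≤s , ss≈d) = 0<y-x⇒x<y (0<x∧0<xy⇒0<y (+-nonneg-pos 0≤s 0<1) (<-respʳ-≈
    (trans (+-congʳ (sym ss≈d)) (solve 1 (λ s → s :* s :- :1 := (s :+ :1) :* (s :- :1)) refl s))
    (x<y⇒0<y-x 1<d)))

  sparsify-graph : ∀ {d s} (1<d : 1# < d) (s-sqrt : IsSqrt s d) n .{{_ : NonZero n}} (G : WeightedGraph n) m →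
    d * (fromℕ n - 1#) ≤ fromℕ m → Sparsifier G m (approximationFactor d s 1<d s-sqrt)
  -- A single vertex leaves no coordinate after grounding, so the barrier argument would have no
  -- edge to choose; here the form of G vanishes and G serves as its own sparsifier.
  sparsify-graph 1<d s-sqrt (suc zero) G m _ = G , (λ u v eq → eq) , ℕ.z≤n , λ x →
      ≤-refl
    , ≤-reflexive (trans (trivial x) (sym (trans (*-congˡ (trivial x)) (zeroʳ _))))
    where
    trivial : ∀ x → quadForm (laplacian G) x ≈ 0#
    trivial x = trans (laplacian-form G x) (trans (+-identityʳ _) (+-identityʳ _))
  sparsify-graph {d} {s} 1<d s-sqrt (suc (suc N)) G m d[n-1]≤m =
    Augmentation.restrict-sparsifier G
      (Grounded.sparsify-connected (Augmentation.augmented G) (Augmentation.augmented-connected G)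
        s (approximationFactor d s 1<d s-sqrt) (1<sqrt 1<d s-sqrt) (factor-spec 1<d s-sqrt) m
        (≤-resp (trans (*-congʳ (sym (proj₂ s-sqrt))) (solve 2 (λ s n → s :* s :* (:1 :+ n :- :1) := n :* (s :* s)) refl s (fromℕ (suc N)))) refl d[n-1]≤m))

theorem1p1 : ∀ {c ℓ₁ ℓ₂} (ℝ : RealNumbers c ℓ₁ ℓ₂) →
    let open GraphsOver ℝ in
    (d √d : Carrier) (1<d : 1# < d) (√d-isSqrt : IsSqrt √d d)
    (n : ℕ) .{{_ : NonZero n}} (G : WeightedGraph n)
    (m : ℕ) → IsCeiling m (d * (fromℕ n - 1#)) →
    Σ (WeightedGraph n) λ H →
    (H ⊆ᴱ G) ×
    (numEdges H ℕ.≤ m) ×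
    (averageDegree H ≤ fromℕ 2 * d) ×
    (∀ (x : Vector Carrier n) →
    (quadForm (laplacian G) x ≤ quadForm (laplacian H) x) ×
    (quadForm (laplacian H) x ≤
    approximationFactor d √d 1<d √d-isSqrt * quadForm (laplacian G) x))
theorem1p1 ℝ d √d 1<d √d-isSqrt n G m (d[n-1]≤m , m<d[n-1]+1) =
  H , H⊆G , size , Components.averageDegree-bound ℝ 1<d n H m m<d[n-1]+1 size , bounds
  where
  open GraphsOver ℝ
  sparsifier = Components.sparsify-graph ℝ 1<d √d-isSqrt n G m d[n-1]≤m
  H = proj₁ sparsifier
  H⊆G = proj₁ (proj₂ sparsifier)
  size = proj₁ (proj₂ (proj₂ sparsifier))
  bounds = proj₂ (proj₂ (proj₂ sparsifier))
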